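{- Let $k\geq2$ and let $\tau\in S_k(312)$ have normal form $\tau=\tau^{(0)}m_0\tau^{(1)}m_1\cdots\tau^{(r)}m_r$, with prefixes $\Theta^{(j)}$ and suffixes $\Theta^{<j>}$. Write $F_w=F_w(x,q)$. (i) If $\tau^{(0)}=\emptyset$, then $$F_\tau=1+xq+x(F_{\tau}-1)+xq(F_{\Theta^{<1>}}-1)+x\sum_{j=1}^{r}(F_{\Theta^{(j)}}-F_{\Theta^{(j-1)}})(F_{\Theta^{<j>}}-1).$$ (ii) If $\tau^{(0)}\neq\emptyset$, then \begin{align*} F_\tau&=1+xq+x(F_{\tau^{(0)}}-1)\delta_{r=0}+x(F_{\tau}-1)\delta_{r\geq1}+xq(F_\tau-1)\\ &\quad+x\sum_{j=2}^{r}(F_{\Theta^{(j)}}-F_{\Theta^{(j-1)}})(F_{\Theta^{<j>}}-1)\\ &\quad+x(F_{\Theta^{(1)}}-F_{\tau^{(0)}})(F_{\Theta^{<1>}}-1)\delta_{r\geq1}+x(F_{\tau^{(0)}}-1)(F_{\tau}-1), \end{align*} where $\delta_\chi$ is $1$ if condition $\chi$ holds and $0$ otherwise.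
   Context: $S_n$ is the set of permutations of $[n]$; pattern containment/avoidance is the usual one, and $S_n(T)$ is the set of permutations in $S_n$ avoiding all patterns in $T$. For $\sigma\in S_n$, $L_n(\sigma)$ is the length of a longest increasing subsequence of $\sigma$ (with $L_0=0$ for the empty permutation). For $\tau\in S_k(312)$, $k\geq1$, define $F_\tau(x,q)=\sum_{n\geq0}\sum_{\sigma\in S_n(312,\tau)}x^nq^{L_n(\sigma)}$ (so $F_1\equiv1$). For a sequence $w$ of distinct integers, $F_w:=F_v$ where $v$ is the reduced form of $w$ (the permutation with the same relative order), and $F_\emptyset:=0$. Normal form: if $m_0=1<m_1<\dots<m_r$ are the right-to-left minima of $\tau$ (entries smaller than all entries to their right), listed left to right, then $\tau=\tau^{(0)}m_0\tau^{(1)}m_1\cdots\tau^{(r)}m_r$ with $m_0<\tau^{(0)}<m_1<\tau^{(1)}<\cdots<m_r<\tau^{(r)}$ (each block possibly empty; $A<B$ means every entry of $A$ is smaller than every entry of $B$). Prefix: $\Theta^{(j)}=\tau^{(0)}m_0\cdots\tau^{(j)}m_j$ for $0\le j\le r$, $\Theta^{(-1)}=\emptyset$. Suffix: $\Theta^{<j>}$ is the reduced form of $\tau^{(j)}m_j\cdots\tau^{(r)}m_r$. -}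

module Defs where

open import Data.Bool using (Bool; true; false; _∧_; _∨_; not; if_then_else_)
open import Data.Nat using (ℕ; zero; suc; _+_; _∸_; _⊔_; _<ᵇ_; _≡ᵇ_; _≤_; _<_)
open import Data.List using (List; []; _∷_; map; concat; concatMap; filter; length; take; drop; foldr; upTo; reverse)
open import Data.List.Relation.Binary.Permutation.Propositional using (_↭_)
open import Data.Integer using (ℤ; +_; _-_) renaming (_+_ to _+ℤ_; _*_ to _*ℤ_)
open import Relation.Binary.PropositionalEquality using (_≡_)
open import Relation.Nullary using (¬_)
open import Data.Product using (_×_)

oneTo : ℕ → List ℕ
oneTo n = map suc (upTo n)

allGreater : ℕ → List ℕ → Bool
allGreater x [] = true
allGreater x (y ∷ ys) = (x <ᵇ y) ∧ allGreater x ys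

countLess : ℕ → List ℕ → ℕ
countLess x [] = 0
countLess x (y ∷ ys) = (if y <ᵇ x then 1 else 0) + countLess x ys

-- reduced form (standardisation) of a sequence of distinct integers:
-- each entry is replaced by its rank 1..length
red : List ℕ → List ℕ
red w = map (λ x → suc (countLess x w)) w

_==ᴸ_ : List ℕ → List ℕ → Bool
[] ==ᴸ [] = true
[] ==ᴸ (_ ∷ _) = false
(_ ∷ _) ==ᴸ [] = false
(x ∷ xs) ==ᴸ (y ∷ ys) = (x ≡ᵇ y) ∧ (xs ==ᴸ ys)

subseqs : List ℕ → List (List ℕ)
subseqs [] = [] ∷ []
subseqs (x ∷ xs) = map (x ∷_) (subseqs xs) Data.List.++ subseqs xs

anyB : List Bool → Bool
anyB = foldr _∨_ false

containsB : List ℕ → List ℕ → Bool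
containsB σ π = anyB (map (λ s → red s ==ᴸ red π) (subseqs σ))

avoidsB : List ℕ → List ℕ → Bool
avoidsB σ π = not (containsB σ π)

increasingB : List ℕ → Bool
increasingB [] = true
increasingB (x ∷ []) = true
increasingB (x ∷ y ∷ ys) = (x <ᵇ y) ∧ increasingB (y ∷ ys)

maxℕ : List ℕ → ℕ
maxℕ = foldr _⊔_ 0

LIS : List ℕ → ℕ
LIS σ = maxℕ (map length (filter (λ s → Data.Bool._≟_ (increasingB s) true) (subseqs σ)))

insertions : ℕ → List ℕ → List (List ℕ)
insertions x [] = (x ∷ []) ∷ []
insertions x (y ∷ ys) = (x ∷ y ∷ ys) ∷ map (y ∷_) (insertions x ys)

perms : ℕ → List (List ℕ)
perms zero = [] ∷ []
perms (suc n) = concatMap (insertions (suc n)) (perms n)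

pat312 : List ℕ
pat312 = 3 ∷ 1 ∷ 2 ∷ []

-- Formal power series in x and q with integer coefficients:
-- s n m = coefficient of x^n q^m.

Series : Set
Series = ℕ → ℕ → ℤ

sumℤ : List ℤ → ℤ
sumℤ = foldr _+ℤ_ (+ 0)

0ˢ : Series
0ˢ n m = + 0

1ˢ : Series
1ˢ zero zero = + 1
1ˢ _ _ = + 0

xˢ : Series
xˢ (suc zero) zero = + 1
xˢ _ _ = + 0

qˢ : Series
qˢ zero (suc zero) = + 1
qˢ _ _ = + 0

infixl 6 _⊕_ _⊖_
infixl 7 _⊗_

_⊕_ : Series → Series → Series
(f ⊕ g) n m = f n m +ℤ g n m

_⊖_ : Series → Series → Series
(f ⊖ g) n m = f n m - g n m

_⊗_ : Series → Series → Series
(f ⊗ g) n m = sumℤ (map (λ i → sumℤ (map (λ j → f i j *ℤ g (n ∸ i) (m ∸ j)) (upTo (suc m)))) (upTo (suc n)))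

sumˢ : List Series → Series
sumˢ = foldr _⊕_ 0ˢ

δ : Bool → Series → Series
δ b f = if b then f else 0ˢ

_≈ˢ_ : Series → Series → Set
f ≈ˢ g = ∀ n m → f n m ≡ g n m

fromTo : ℕ → ℕ → List ℕ
fromTo a b = map (λ i → a + i) (upTo (suc b ∸ a))

-- F_τ(x,q) = Σ_n Σ_{σ ∈ S_n(312,τ)} x^n q^{L_n(σ)}, and F_w := F_{red w}.
-- (For w = ∅, every σ contains the empty pattern, so F_∅ = 0.)

Fcoef : List ℕ → ℕ → ℕ → ℕ
Fcoef τ n m = length (filter (λ σ → Data.Bool._≟_ (avoidsB σ pat312 ∧ avoidsB σ τ ∧ (LIS σ ≡ᵇ m)) true) (perms n))

F : List ℕ → Series
F w n m = + Fcoef (red w) n m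

-- Normal form via right-to-left minima.
-- blocks τ = [ τ^(0) m_0 , τ^(1) m_1 , … , τ^(r) m_r ]: τ is cut right
-- after each right-to-left minimum.

blocksAux : List ℕ → List ℕ → List (List ℕ)
blocksAux acc [] = []
blocksAux acc (x ∷ rest) =
  if allGreater x rest then reverse (x ∷ acc) ∷ blocksAux [] rest
  else blocksAux (x ∷ acc) rest

blocks : List ℕ → List (List ℕ)
blocks τ = blocksAux [] τ

rOf : List ℕ → ℕ
rOf τ = length (blocks τ) ∸ 1

dropLast : List ℕ → List ℕ
dropLast [] = []
dropLast (x ∷ []) = []
dropLast (x ∷ y ∷ ys) = x ∷ dropLast (y ∷ ys)

tau0 : List ℕ → List ℕ
tau0 τ with blocks τ
... | [] = []
... | b ∷ _ = dropLast b

Θpre : List ℕ → ℕ → List ℕ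
Θpre τ j = concat (take (suc j) (blocks τ))

-- Θ^(j-1), as a function of j ≥ 1 (Θ^(-1) = ∅ when j = 0)
Θpre' : List ℕ → ℕ → List ℕ
Θpre' τ j = concat (take j (blocks τ))

Θsuf : List ℕ → ℕ → List ℕ
Θsuf τ j = red (concat (drop j (blocks τ)))

InS312 : ℕ → List ℕ → Set
InS312 k τ = (τ ↭ oneTo k) × (avoidsB τ pat312 ≡ true)


isZero : ℕ → Bool
isZero zero = true
isZero (suc _) = false

isNonZero : ℕ → Bool
isNonZero n = not (isZero n)

{-# OPTIONS --safe #-}
-- A 312-avoider σ factors as α 1 β with 1 < α < β, so it is a binary tree with subtrees α and β, and
-- its longest increasing subsequences have length max(1, L(α)) + L(β).  The blocks B_j = τ^(j) m_j of
-- the normal form are indecomposable for direct sums, hence α 1 β contains τ = B_0 ⊕ ⋯ ⊕ B_r iff for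
-- some j the first j blocks occur in α 1 and the remaining ones in β.  For j ≥ 2 the first j blocks do
-- not end with their minimum, so they already occur in α; for j = 1 it suffices that τ^(0) occurs in α.
-- As j grows the first condition gets stronger and the second one weaker, so the indicator of avoidance
-- telescopes into Σ_j ([α avoids prefix j+1] − [α avoids prefix j]) · [β avoids suffix j], which
-- becomes the functional equation after summation over all pairs (α, β).
module Submission where

open import Defs
open import Data.Bool as Bool using (Bool; true; false; _∧_; _∨_; not; if_then_else_)
open import Data.Bool.Properties using (T-≡; ∨-zeroʳ)
open import Data.Empty using (⊥-elim)
open import Data.Integer using (ℤ; +_; _-_; 0ℤ; 1ℤ) renaming (_+_ to _+ℤ_; _*_ to _*ℤ_)
import Data.Integer.Properties as ℤ
open import Data.Integer.Tactic.RingSolver using (solve-∀)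
open import Data.List using (List; []; _∷_; _++_; map; length; filter; concat; concatMap;
  cartesianProductWith; take; drop; upTo; applyUpTo; reverse; initLast; _∷ʳ′_)
open import Data.List.Membership.Propositional using (_∈_; _∉_; find; lose)
open import Data.List.Membership.Propositional.Properties
open import Data.List.Membership.Propositional.Properties.WithK using (unique∧set⇒bag)
open import Data.List.Properties using (∷-injective; ∷ʳ-injective; ++-assoc; ++-identityʳ; ++-conicalˡ;
  ++-conicalʳ; length-++; length-map; length-upTo; map-++; map-∘; map-id; map-cong-local; map-upTo;
  map-applyUpTo; upTo-∷ʳ; take-all; take++drop≡id; concat-++; unfold-reverse)
open import Data.List.Relation.Binary.BagAndSetEquality using (∼bag⇒↭)
open import Data.List.Relation.Binary.Permutation.Propositional using (_↭_; ↭-refl; ↭-sym; ↭-trans; ↭-prep;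
  ↭-reflexive; ↭⇒↭ₛ)
import Data.List.Relation.Binary.Permutation.Propositional.Properties as ↭
import Data.List.Relation.Binary.Permutation.Setoid.Properties as ↭ₛ
open import Data.List.Relation.Binary.Sublist.Propositional using (_⊆_; []; _∷_; _∷ʳ_; ⊆-refl; ⊆-trans;
  minimum; lookup; from∈)
open import Data.List.Relation.Binary.Sublist.Propositional.Properties using (++⁺; ++⁺ˡ; ++⁺ʳ; map⁺;
  All-resp-⊆)
open import Data.List.Relation.Unary.All as All using (All; []; _∷_)
import Data.List.Relation.Unary.All.Properties as All
open import Data.List.Relation.Unary.AllPairs as AllPairs using (AllPairs; []; _∷_)
import Data.List.Relation.Unary.AllPairs.Properties as AllPairs
open import Data.List.Relation.Unary.Any using (here; there)
import Data.List.Relation.Unary.Any.Properties as Any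
open import Data.List.Relation.Unary.Linked using (Linked; []; [-]; _∷_)
open import Data.List.Relation.Unary.Linked.Properties using (Linked⇒AllPairs; AllPairs⇒Linked)
open import Data.List.Relation.Unary.Unique.Propositional using (Unique)
import Data.List.Relation.Unary.Unique.Propositional.Properties as Unique
open import Data.Nat using (ℕ; zero; suc; _+_; _∸_; _⊔_; _≤_; _<_; _<ᵇ_; _≡ᵇ_; z≤n; s≤s; s≤s⁻¹)
open import Data.Nat.Properties
open import Data.Product using (_×_; _,_; proj₁; proj₂; ∃; ∃₂)
open import Data.Sum using (_⊎_; inj₁; inj₂)
open import Data.Unit using (⊤; tt)
open import Function using (_∘_; case_of_; mk⇔; Equivalence; _⇔_)
open import Relation.Binary.PropositionalEquality using (_≡_; _≢_; refl; sym; trans; cong; cong₂; subst;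
  subst₂; setoid; module ≡-Reasoning)
open import Relation.Nullary using (¬_)
open import Relation.Nullary.Decidable using (does-⇔)

open Equivalence using (to; from)
open ≡-Reasoning

-- Pattern containment

-- The functional equation is checked coefficientwise on each pair (α, β), and its terms come from
-- asking whether α and β are empty. If α is empty, max(1, L(α)) exceeds L(α) by one; these pairs
-- give the terms with factor xq. If only β is empty, it avoids every nonempty suffix, so the
-- telescoping sum collapses to its last value; this is the term x(F - 1) for τ, or for τ^(0) when r
-- = 0. If both are nonempty the sum itself remains, and the factors F - 1 restrict it to nonempty
-- β. The two shapes of the equation come from j = 1, where α has to contain τ^(0) rather than the
-- first block. For empty τ^(0) this always holds; otherwise it yields the summands with F of τ^(0)
-- that stand apart from the sum. Trees are used because containment can be described on them
-- without renumbering α and β. Every product of series becomes a sum over pairs of trees, so that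
-- only integer identities remain.

infix 4 _≺_
_≺_ : List ℕ → List ℕ → Set
xs ≺ ys = All (λ x → All (x <_) ys) xs

<ᵇ-cong : ∀ {a b c d} → (a < b → c < d) → (c < d → a < b) → (a <ᵇ b) ≡ (c <ᵇ d)
<ᵇ-cong {a} {b} {c} {d} f g = does-⇔ (mk⇔ f g) (a <? b) (c <? d)

<ᵇ-true : ∀ {a b} → a < b → (a <ᵇ b) ≡ true
<ᵇ-true = to T-≡ ∘ <⇒<ᵇ

<ᵇ-true⁻ : ∀ {a b} → (a <ᵇ b) ≡ true → a < b
<ᵇ-true⁻ = <ᵇ⇒< _ _ ∘ from T-≡

∧-true : ∀ {a b} → a ∧ b ≡ true → a ≡ true × b ≡ true
∧-true {true} p = refl , p

≢true⇒≡false : ∀ {b} → ¬ b ≡ true → b ≡ false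
≢true⇒≡false {true} p = ⊥-elim (p refl)
≢true⇒≡false {false} p = refl

==ᴸ-refl : ∀ xs → (xs ==ᴸ xs) ≡ true
==ᴸ-refl [] = refl
==ᴸ-refl (x ∷ xs) = cong₂ _∧_ (to T-≡ (≡⇒≡ᵇ x x refl)) (==ᴸ-refl xs)

==ᴸ⇒≡ : ∀ xs ys → (xs ==ᴸ ys) ≡ true → xs ≡ ys
==ᴸ⇒≡ [] [] p = refl
==ᴸ⇒≡ (x ∷ xs) (y ∷ ys) p =
  cong₂ _∷_ (≡ᵇ⇒≡ x y (from T-≡ (proj₁ (∧-true p)))) (==ᴸ⇒≡ xs ys (proj₂ (∧-true p)))

anyB-map⁺ : ∀ {A : Set} (p : A → Bool) {x xs} → x ∈ xs → p x ≡ true → anyB (map p xs) ≡ true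
anyB-map⁺ p {xs = _ ∷ xs} (here refl) px = cong (_∨ anyB (map p xs)) px
anyB-map⁺ p {xs = y ∷ _} (there x∈) px = trans (cong (p y ∨_) (anyB-map⁺ p x∈ px)) (∨-zeroʳ (p y))

anyB-map⁻ : ∀ {A : Set} (p : A → Bool) xs → anyB (map p xs) ≡ true → ∃ λ x → x ∈ xs × p x ≡ true
anyB-map⁻ p (x ∷ xs) eq with p x in px
... | true = x , here refl , px
... | false with anyB-map⁻ p xs eq
...   | y , y∈ , py = y , there y∈ , py

⊆⇒∈subseqs : ∀ {s σ} → s ⊆ σ → s ∈ subseqs σ
⊆⇒∈subseqs [] = here refl
⊆⇒∈subseqs {σ = x ∷ σ} (_ ∷ʳ p) = ∈-++⁺ʳ (map (x ∷_) (subseqs σ)) (⊆⇒∈subseqs p)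
⊆⇒∈subseqs (refl ∷ p) = ∈-++⁺ˡ (∈-map⁺ _ (⊆⇒∈subseqs p))

∈subseqs⇒⊆ : ∀ {s} σ → s ∈ subseqs σ → s ⊆ σ
∈subseqs⇒⊆ [] (here refl) = []
∈subseqs⇒⊆ (x ∷ σ) s∈ with ∈-++⁻ (map (x ∷_) (subseqs σ)) s∈
... | inj₂ q = x ∷ʳ ∈subseqs⇒⊆ σ q
... | inj₁ q with ∈-map⁻ (x ∷_) q
...   | _ , q′ , refl = refl ∷ ∈subseqs⇒⊆ σ q′

⊆-++⁻ : ∀ {A : Set} {s : List A} xs {ys} → s ⊆ xs ++ ys →
        ∃₂ λ s₁ s₂ → s ≡ s₁ ++ s₂ × s₁ ⊆ xs × s₂ ⊆ ys
⊆-++⁻ [] p = [] , _ , refl , [] , p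
⊆-++⁻ (x ∷ xs) (_ ∷ʳ p) with ⊆-++⁻ xs p
... | s₁ , s₂ , eq , p₁ , p₂ = s₁ , s₂ , eq , x ∷ʳ p₁ , p₂
⊆-++⁻ (x ∷ xs) (refl ∷ p) with ⊆-++⁻ xs p
... | s₁ , s₂ , eq , p₁ , p₂ = x ∷ s₁ , s₂ , cong (x ∷_) eq , refl ∷ p₁ , p₂

⊆-map⁻ : ∀ {A B : Set} (f : A → B) {s} xs → s ⊆ map f xs → ∃ λ ys → ys ⊆ xs × map f ys ≡ s
⊆-map⁻ f [] [] = [] , [] , refl
⊆-map⁻ f (x ∷ xs) (_ ∷ʳ p) with ⊆-map⁻ f xs p
... | ys , q , eq = ys , x ∷ʳ q , eq
⊆-map⁻ f (x ∷ xs) (refl ∷ p) with ⊆-map⁻ f xs p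
... | ys , q , eq = x ∷ ys , refl ∷ q , cong (f x ∷_) eq

map-≡-++⁻ : ∀ {A B : Set} (f : A → B) zs xs {ys} → map f zs ≡ xs ++ ys →
            ∃₂ λ z₁ z₂ → zs ≡ z₁ ++ z₂ × map f z₁ ≡ xs × map f z₂ ≡ ys
map-≡-++⁻ f zs [] eq = [] , zs , refl , refl , eq
map-≡-++⁻ f (z ∷ zs) (x ∷ xs) eq with map-≡-++⁻ f zs xs (proj₂ (∷-injective eq))
... | z₁ , z₂ , e , e₁ , e₂ = z ∷ z₁ , z₂ , cong (z ∷_) e , cong₂ _∷_ (proj₁ (∷-injective eq)) e₁ , e₂

-- A list of position-wise pairs is coherent when its two projections are order isomorphic.
Coherent : List (ℕ × ℕ) → Set
Coherent z = ∀ {p q} → p ∈ z → q ∈ z → proj₁ p < proj₁ q ⇔ proj₂ p < proj₂ q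

-- The witness is the list of matched pairs rather than a standardised subsequence, so cutting
-- either the permutation or the pattern cuts the witness as well.
Contains : List ℕ → List ℕ → Set
Contains σ π = ∃ λ z → map proj₁ z ⊆ σ × map proj₂ z ≡ π × Coherent z

rank : List ℕ → ℕ → ℕ
rank w x = suc (countLess x w)

countLess-coherent : ∀ {p} z → (∀ {q} → q ∈ z → proj₁ q < proj₁ p ⇔ proj₂ q < proj₂ p) →
                     countLess (proj₁ p) (map proj₁ z) ≡ countLess (proj₂ p) (map proj₂ z)
countLess-coherent [] c = refl
countLess-coherent (q ∷ z) c = cong₂ (λ b n → (if b then 1 else 0) + n)
  (<ᵇ-cong (to (c (here refl))) (from (c (here refl)))) (countLess-coherent z (c ∘ there))

coherent⇒red≡ : ∀ z → Coherent z → red (map proj₁ z) ≡ red (map proj₂ z)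
coherent⇒red≡ z c = go z (λ p∈ → p∈)
  where
  go : ∀ y → (∀ {p} → p ∈ y → p ∈ z) →
       map (rank (map proj₁ z)) (map proj₁ y) ≡ map (rank (map proj₂ z)) (map proj₂ y)
  go [] y⊆z = refl
  go (p ∷ y) y⊆z =
    cong₂ _∷_ (cong suc (countLess-coherent z (λ q∈ → c q∈ (y⊆z (here refl))))) (go y (y⊆z ∘ there))

[<]-mono : ∀ z {x y} → x ≤ y → (if z <ᵇ x then 1 else 0) ≤ (if z <ᵇ y then 1 else 0)
[<]-mono z {x} {y} x≤y with z <ᵇ x in e
... | false = z≤n
... | true rewrite <ᵇ-true (<-≤-trans (<ᵇ-true⁻ {z} e) x≤y) = ≤-refl

countLess-mono-≤ : ∀ w {x y} → x ≤ y → countLess x w ≤ countLess y w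
countLess-mono-≤ [] x≤y = z≤n
countLess-mono-≤ (z ∷ w) x≤y = +-mono-≤ ([<]-mono z x≤y) (countLess-mono-≤ w x≤y)

countLess-mono-< : ∀ {w x y} → x ∈ w → x < y → countLess x w < countLess y w
countLess-mono-< {z ∷ w} (here refl) x<y
  rewrite ≢true⇒≡false (λ e → <-irrefl refl (<ᵇ-true⁻ {z} {z} e)) | <ᵇ-true x<y =
  s≤s (countLess-mono-≤ w (<⇒≤ x<y))
countLess-mono-< {z ∷ w} (there x∈) x<y = +-mono-≤-< ([<]-mono z (<⇒≤ x<y)) (countLess-mono-< x∈ x<y)

rank-⇔ : ∀ {w x y} → x ∈ w → x < y ⇔ rank w x < rank w y
rank-⇔ {w} x∈ = mk⇔ (λ x<y → s≤s (countLess-mono-< x∈ x<y))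
  (λ r → ≰⇒> (λ y≤x → <⇒≱ r (s≤s (countLess-mono-≤ w y≤x))))

zip-map≡ : ∀ (f g : ℕ → ℕ) s t → map f s ≡ map g t →
           ∃ λ z → map proj₁ z ≡ s × map proj₂ z ≡ t × (∀ {p} → p ∈ z → f (proj₁ p) ≡ g (proj₂ p))
zip-map≡ f g [] [] eq = [] , refl , refl , λ ()
zip-map≡ f g (x ∷ s) (y ∷ t) eq with zip-map≡ f g s t (proj₂ (∷-injective eq))
... | z , e₁ , e₂ , h = (x , y) ∷ z , cong (x ∷_) e₁ , cong (y ∷_) e₂ ,
  λ { (here refl) → proj₁ (∷-injective eq) ; (there p∈) → h p∈ }

-- On the entries of a list, `rank` preserves and reflects the order, so both comparisons of two
-- matched pairs amount to comparing their common ranks.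
red≡⇒coherent : ∀ s t → red s ≡ red t → ∃ λ z → map proj₁ z ≡ s × map proj₂ z ≡ t × Coherent z
red≡⇒coherent s t eq with zip-map≡ (rank s) (rank t) s t eq
... | z , refl , refl , h = z , refl , refl , λ p∈ q∈ → mk⇔
  (λ lt → from (rank-⇔ (∈-map⁺ proj₂ p∈)) (subst₂ _<_ (h p∈) (h q∈) (to (rank-⇔ (∈-map⁺ proj₁ p∈)) lt)))
  (λ lt → from (rank-⇔ (∈-map⁺ proj₁ p∈))
            (subst₂ _<_ (sym (h p∈)) (sym (h q∈)) (to (rank-⇔ (∈-map⁺ proj₂ p∈)) lt)))

red-idem : ∀ w → red (red w) ≡ red w
red-idem w = sym (trans (cong red (sym fst)) (trans (coherent⇒red≡ z coh) (cong red snd)))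
  where
  z = map (λ x → x , rank w x) w
  fst : map proj₁ z ≡ w
  fst = trans (sym (map-∘ w)) (map-id w)
  snd : map proj₂ z ≡ red w
  snd = sym (map-∘ w)
  coh : Coherent z
  coh p∈ q∈ with ∈-map⁻ _ p∈ | ∈-map⁻ _ q∈
  ... | x , x∈ , refl | y , y∈ , refl = rank-⇔ x∈

avoidsB-red : ∀ σ w → avoidsB σ (red w) ≡ avoidsB σ w
avoidsB-red σ w = cong (λ r → not (anyB (map (λ s → red s ==ᴸ r) (subseqs σ)))) (red-idem w)

Contains⇒containsB : ∀ {σ π} → Contains σ π → containsB σ π ≡ true
Contains⇒containsB (z , sub , refl , coh) =
  anyB-map⁺ _ (⊆⇒∈subseqs sub)
    (trans (cong (_==ᴸ red (map proj₂ z)) (coherent⇒red≡ z coh)) (==ᴸ-refl (red (map proj₂ z))))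

containsB⇒Contains : ∀ {σ π} → containsB σ π ≡ true → Contains σ π
containsB⇒Contains {σ} {π} e with anyB-map⁻ _ (subseqs σ) e
... | s , s∈ , r with red≡⇒coherent s π (==ᴸ⇒≡ (red s) (red π) r)
...   | z , refl , e₂ , coh = z , ∈subseqs⇒⊆ σ s∈ , e₂ , coh

coherent-⊆ : ∀ {y z} → y ⊆ z → Coherent z → Coherent y
coherent-⊆ y⊆z c p∈ q∈ = c (lookup y⊆z p∈) (lookup y⊆z q∈)

contains-⊆ˡ : ∀ {σ σ′ w} → σ ⊆ σ′ → Contains σ w → Contains σ′ w
contains-⊆ˡ σ⊆ (z , sub , e , c) = z , ⊆-trans sub σ⊆ , e , c

contains-⊆ʳ : ∀ {σ w w′} → w′ ⊆ w → Contains σ w → Contains σ w′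
contains-⊆ʳ w′⊆ (z , sub , refl , c) with ⊆-map⁻ proj₂ z w′⊆
... | y , y⊆z , e = y , ⊆-trans (map⁺ proj₁ y⊆z) sub , e , coherent-⊆ y⊆z c

contains-[] : ∀ {σ} → Contains σ []
contains-[] = [] , minimum _ , refl , λ ()

≺⇒< : ∀ {xs ys x y} → xs ≺ ys → x ∈ xs → y ∈ ys → x < y
≺⇒< lt x∈ y∈ = All.lookup (All.lookup lt x∈) y∈

<⇒≺ : ∀ {xs ys} → (∀ {x y} → x ∈ xs → y ∈ ys → x < y) → xs ≺ ys
<⇒≺ f = All.tabulate λ x∈ → All.tabulate λ y∈ → f x∈ y∈

contains-⊕⁺ : ∀ {A B w₁ w₂} → A ≺ B → w₁ ≺ w₂ → Contains A w₁ → Contains B w₂ →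
              Contains (A ++ B) (w₁ ++ w₂)
contains-⊕⁺ {A} {B} A≺B w≺ (z₁ , s₁ , refl , c₁) (z₂ , s₂ , refl , c₂) =
  z₁ ++ z₂ ,
  subst (_⊆ A ++ B) (sym (map-++ proj₁ z₁ z₂)) (++⁺ s₁ s₂) ,
  map-++ proj₂ z₁ z₂ , coh
  where
  lo : ∀ {p q} → p ∈ z₁ → q ∈ z₂ → proj₁ p < proj₁ q
  lo p∈ q∈ = ≺⇒< A≺B (lookup s₁ (∈-map⁺ proj₁ p∈)) (lookup s₂ (∈-map⁺ proj₁ q∈))
  hi : ∀ {p q} → p ∈ z₁ → q ∈ z₂ → proj₂ p < proj₂ q
  hi p∈ q∈ = ≺⇒< w≺ (∈-map⁺ proj₂ p∈) (∈-map⁺ proj₂ q∈)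
  coh : Coherent (z₁ ++ z₂)
  coh p∈ q∈ with ∈-++⁻ z₁ p∈ | ∈-++⁻ z₁ q∈
  ... | inj₁ p | inj₁ q = c₁ p q
  ... | inj₂ p | inj₂ q = c₂ p q
  ... | inj₁ p | inj₂ q = mk⇔ (λ _ → hi p q) (λ _ → lo p q)
  ... | inj₂ p | inj₁ q = mk⇔ (λ l → ⊥-elim (<-asym l (lo q p))) (λ l → ⊥-elim (<-asym l (hi q p)))

contains-⊕⁻ : ∀ A {B w} → A ≺ B → Contains (A ++ B) w →
              ∃₂ λ w₁ w₂ → w ≡ w₁ ++ w₂ × w₁ ≺ w₂ × Contains A w₁ × Contains B w₂
contains-⊕⁻ A A≺B (z , sub , refl , c) with ⊆-++⁻ A sub
... | s₁ , s₂ , e , sub₁ , sub₂ with map-≡-++⁻ proj₁ z s₁ e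
...   | z₁ , z₂ , refl , refl , refl =
  map proj₂ z₁ , map proj₂ z₂ , map-++ proj₂ z₁ z₂ , <⇒≺ lt ,
  (z₁ , sub₁ , refl , λ p q → c (∈-++⁺ˡ p) (∈-++⁺ˡ q)) ,
  (z₂ , sub₂ , refl , λ p q → c (∈-++⁺ʳ z₁ p) (∈-++⁺ʳ z₁ q))
  where
  lt : ∀ {x y} → x ∈ map proj₂ z₁ → y ∈ map proj₂ z₂ → x < y
  lt x∈ y∈ with ∈-map⁻ proj₂ x∈ | ∈-map⁻ proj₂ y∈
  ... | p , p∈ , refl | q , q∈ , refl =
    to (c (∈-++⁺ˡ p∈) (∈-++⁺ʳ z₁ q∈))
       (≺⇒< A≺B (lookup sub₁ (∈-map⁺ proj₁ p∈)) (lookup sub₂ (∈-map⁺ proj₁ q∈)))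

-- The parameter allows two uses: with the trivial `P` these are the blocks τ^(j) m_j, and with
-- containment for `P` they are the patterns whose last entry is matched with the final 1 of α 1.
SkewMin : (List ℕ → Set) → List ℕ → Set
SkewMin P w = ∃₂ λ u m → w ≡ u ++ m ∷ [] × All (m <_) u × P u

contains-⊖1⁺ : ∀ {A o w} → All (o <_) A → SkewMin (Contains A) w → Contains (A ++ o ∷ []) w
contains-⊖1⁺ {A} {o} o<A (_ , m , refl , m< , z , sub , refl , c) =
  z ++ (o , m) ∷ [] ,
  subst (_⊆ A ++ o ∷ []) (sym (map-++ proj₁ z _)) (++⁺ sub ⊆-refl) ,
  map-++ proj₂ z _ , coh
  where
  lo : ∀ {p} → p ∈ z → o < proj₁ p
  lo p∈ = All.lookup o<A (lookup sub (∈-map⁺ proj₁ p∈))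
  hi : ∀ {p} → p ∈ z → m < proj₂ p
  hi p∈ = All.lookup m< (∈-map⁺ proj₂ p∈)
  coh : Coherent (z ++ (o , m) ∷ [])
  coh p∈ q∈ with ∈-++⁻ z p∈ | ∈-++⁻ z q∈
  ... | inj₁ p | inj₁ q = c p q
  ... | inj₂ (here refl) | inj₁ q = mk⇔ (λ _ → hi q) (λ _ → lo q)
  ... | inj₁ p | inj₂ (here refl) = mk⇔ (λ l → ⊥-elim (<-asym l (lo p))) (λ l → ⊥-elim (<-asym l (hi p)))
  ... | inj₂ (here refl) | inj₂ (here refl) = mk⇔ (λ l → ⊥-elim (<-irrefl refl l)) (λ l → ⊥-elim (<-irrefl refl l))

contains-⊖1⁻ : ∀ A {o w} → All (o <_) A → Contains (A ++ o ∷ []) w →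
               Contains A w ⊎ SkewMin (Contains A) w
contains-⊖1⁻ A {o} o<A (z , sub , refl , c) with ⊆-++⁻ A sub
... | s₁ , s₂ , e , sub₁ , sub₂ with map-≡-++⁻ proj₁ z s₁ e
contains-⊖1⁻ A o<A (z , sub , refl , c) | s₁ , s₂ , e , sub₁ , sub₂ | z₁ , [] , refl , refl , e₂ =
  inj₁ (z₁ , sub₁ , sym (trans (map-++ proj₂ z₁ []) (++-identityʳ _)) , λ p q → c (∈-++⁺ˡ p) (∈-++⁺ˡ q))
contains-⊖1⁻ A o<A (z , sub , refl , c) | s₁ , s₂ , e , sub₁ , sub₂ | z₁ , (x , m) ∷ z₂ , refl , refl , refl
  with sub₂
... | _ ∷ʳ ()
... | refl ∷ sub₃ with z₂ | sub₃
...   | [] | [] = inj₂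
  (map proj₂ z₁ , m , map-++ proj₂ z₁ _ , All.tabulate lt ,
   z₁ , sub₁ , refl , λ p q → c (∈-++⁺ˡ p) (∈-++⁺ˡ q))
  where
  lt : ∀ {x} → x ∈ map proj₂ z₁ → m < x
  lt x∈ with ∈-map⁻ proj₂ x∈
  ... | p , p∈ , refl = to (c (∈-++⁺ʳ z₁ (here refl)) (∈-++⁺ˡ p∈)) (All.lookup o<A (lookup sub₁ (∈-map⁺ proj₁ p∈)))

-- 312-avoiders as binary trees

-- node l r stands for α 1 β, where l and r stand for α and β.
data Tree : Set where
  leaf : Tree
  node : Tree → Tree → Tree

size : Tree → ℕ
size leaf = 0
size (node l r) = suc (size l + size r)

-- The 312-avoider of t, written with the entries o + 1, …, o + size t.
perm : ℕ → Tree → List ℕ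
perm o leaf = []
perm o (node l r) = perm (suc o) l ++ suc o ∷ perm (suc o + size l) r

lis : Tree → ℕ
lis leaf = 0
lis (node l r) = (1 ⊔ lis l) + lis r

-- Containment as the shape of a node dictates it. Only entries of the pattern are compared, so the
-- offset at which the tree is written does not enter.
TreeContains : Tree → List ℕ → Set
TreeContains leaf w = w ≡ []
TreeContains (node l r) w = ∃₂ λ w₁ w₂ → w ≡ w₁ ++ w₂ × w₁ ≺ w₂ ×
  (TreeContains l w₁ ⊎ SkewMin (TreeContains l) w₁) × TreeContains r w₂

perm-> : ∀ o t → All (o <_) (perm o t)
perm-> o leaf = []
perm-> o (node l r) =
  All.++⁺ (All.map (≤-trans (n≤1+n _)) (perm-> (suc o) l))
    (≤-refl ∷ All.map (≤-trans (s≤s (≤-trans (n≤1+n o) (m≤m+n _ _)))) (perm-> (suc o + size l) r))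

perm-≤ : ∀ o t → All (_≤ o + size t) (perm o t)
perm-≤ o leaf = []
perm-≤ o (node l r) = subst (λ b → All (_≤ b) (perm o (node l r))) (sym (+-suc o _))
  (All.++⁺ (All.map (λ p → ≤-trans p (s≤s (+-monoʳ-≤ o (m≤m+n _ _)))) (perm-≤ (suc o) l))
    (s≤s (m≤m+n o _) ∷ All.map (λ p → ≤-trans p (≤-reflexive (+-assoc (suc o) _ _))) (perm-≤ (suc o + size l) r)))

-- The bracketing that exhibits a node as a direct sum: the root entry joins the left part, of which
-- it is the last entry and the minimum.
lower : ℕ → Tree → List ℕ
lower o l = perm (suc o) l ++ suc o ∷ []

upper : ℕ → Tree → Tree → List ℕ
upper o l r = perm (suc o + size l) r

perm-node : ∀ o l r → perm o (node l r) ≡ lower o l ++ upper o l r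
perm-node o l r = sym (++-assoc (perm (suc o) l) _ _)

lower≺upper : ∀ o l r → lower o l ≺ upper o l r
lower≺upper o l r = All.map (λ x≤ → All.map (≤-<-trans x≤) (perm-> (suc o + size l) r))
  (All.++⁺ (perm-≤ (suc o) l) (m≤m+n (suc o) _ ∷ []))

contains⇒tree : ∀ o t {w} → Contains (perm o t) w → TreeContains t w
contains⇒tree o leaf ([] , _ , refl , _) = refl
contains⇒tree o leaf (_ ∷ _ , () , _)
contains⇒tree o (node l r) c
  with contains-⊕⁻ (lower o l) (lower≺upper o l r) (subst (λ σ → Contains σ _) (perm-node o l r) c)
... | w₁ , w₂ , e , w≺ , c₁ , c₂ = w₁ , w₂ , e , w≺ , first (contains-⊖1⁻ _ (perm-> (suc o) l) c₁) ,
                                   contains⇒tree _ r c₂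
  where
  first : Contains (perm (suc o) l) w₁ ⊎ SkewMin (Contains (perm (suc o) l)) w₁ → _
  first (inj₁ c) = inj₁ (contains⇒tree (suc o) l c)
  first (inj₂ (u , m , e , m< , c)) = inj₂ (u , m , e , m< , contains⇒tree (suc o) l c)

tree⇒contains : ∀ o t {w} → TreeContains t w → Contains (perm o t) w
tree⇒contains o leaf refl = contains-[]
tree⇒contains o (node l r) (w₁ , w₂ , refl , w≺ , c₁ , c₂) =
  subst (λ σ → Contains σ _) (sym (perm-node o l r))
    (contains-⊕⁺ (lower≺upper o l r) w≺ (first c₁) (tree⇒contains _ r c₂))
  where
  first : TreeContains l w₁ ⊎ SkewMin (TreeContains l) w₁ → Contains (lower o l) w₁
  first (inj₁ c) = contains-⊆ˡ (++⁺ʳ _ ⊆-refl) (tree⇒contains (suc o) l c)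
  first (inj₂ (u , m , e , m< , c)) =
    contains-⊖1⁺ (perm-> (suc o) l) (u , m , e , m< , tree⇒contains (suc o) l c)

tree-⊆ : ∀ t {w w′} → w′ ⊆ w → TreeContains t w → TreeContains t w′
tree-⊆ t w′⊆ c = contains⇒tree 0 t (contains-⊆ʳ w′⊆ (tree⇒contains 0 t c))

tree-[] : ∀ t → TreeContains t []
tree-[] t = contains⇒tree 0 t contains-[]

-- Longest increasing subsequences

increasing⇒AllPairs : ∀ s → increasingB s ≡ true → AllPairs _<_ s
increasing⇒AllPairs s e = Linked⇒AllPairs <-trans (go s e)
  where
  go : ∀ s → increasingB s ≡ true → Linked _<_ s
  go [] e = []
  go (x ∷ []) e = [-]
  go (x ∷ y ∷ s) e = <ᵇ-true⁻ (proj₁ (∧-true e)) ∷ go (y ∷ s) (proj₂ (∧-true {x <ᵇ y} e))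

AllPairs⇒increasing : ∀ {s} → AllPairs _<_ s → increasingB s ≡ true
AllPairs⇒increasing = go ∘ AllPairs⇒Linked
  where
  go : ∀ {s} → Linked _<_ s → increasingB s ≡ true
  go [] = refl
  go [-] = refl
  go (x<y ∷ l) = cong₂ _∧_ (<ᵇ-true x<y) (go l)

maxℕ-lub : ∀ {k xs} → All (_≤ k) xs → maxℕ xs ≤ k
maxℕ-lub [] = z≤n
maxℕ-lub (x≤ ∷ xs≤) = ⊔-lub x≤ (maxℕ-lub xs≤)

∈⇒≤maxℕ : ∀ {x xs} → x ∈ xs → x ≤ maxℕ xs
∈⇒≤maxℕ (here refl) = m≤m⊔n _ _
∈⇒≤maxℕ {xs = y ∷ _} (there x∈) = ≤-trans (∈⇒≤maxℕ x∈) (m≤n⊔m y _)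

LIS-≡ : ∀ {σ k} → (∃ λ s → s ⊆ σ × AllPairs _<_ s × length s ≡ k) →
        (∀ {s} → s ⊆ σ → AllPairs _<_ s → length s ≤ k) → LIS σ ≡ k
LIS-≡ {σ} (s , s⊆ , inc , refl) ub = ≤-antisym
  (maxℕ-lub (All.tabulate bound))
  (∈⇒≤maxℕ (∈-map⁺ length (∈-filter⁺ (λ s → increasingB s Bool.≟ true) (⊆⇒∈subseqs s⊆) (AllPairs⇒increasing inc))))
  where
  bound : ∀ {x} → x ∈ map length (filter (λ s → increasingB s Bool.≟ true) (subseqs σ)) → x ≤ length s
  bound x∈ with ∈-map⁻ length x∈
  ... | s′ , s′∈ , refl with ∈-filter⁻ (λ s → increasingB s Bool.≟ true) {xs = subseqs σ} s′∈
  ...   | s′∈′ , inc′ = ub (∈subseqs⇒⊆ σ s′∈′) (increasing⇒AllPairs s′ inc′)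

AllPairs-++⁻ : ∀ {A : Set} {R : A → A → Set} xs {ys} → AllPairs R (xs ++ ys) →
               AllPairs R xs × AllPairs R ys × (∀ {x y} → x ∈ xs → y ∈ ys → R x y)
AllPairs-++⁻ [] ps = [] , ps , λ ()
AllPairs-++⁻ (x ∷ xs) (p ∷ ps) with AllPairs-++⁻ xs ps
... | qs , rs , c = All.++⁻ˡ xs p ∷ qs , rs ,
  λ { (here refl) y∈ → All.lookup (All.++⁻ʳ xs p) y∈ ; (there x∈) y∈ → c x∈ y∈ }

longest : ∀ o t → ∃ λ s → s ⊆ perm o t × AllPairs _<_ s × length s ≡ lis t
longest o leaf = [] , [] , [] , refl
longest o (node l r) with longest (suc o) l | longest (suc o + size l) r
... | s₁ , s₁⊆ , i₁ , e₁ | s₂ , s₂⊆ , i₂ , e₂ with lis l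
-- Nothing increasing can be gained from the left subtree, so the root entry itself supplies the 1
-- in `1 ⊔ lis l`.
...   | zero = suc o ∷ s₂ , ++⁺ˡ (perm (suc o) l) (refl ∷ s₂⊆) ,
               All-resp-⊆ s₂⊆ (All.map (≤-<-trans (m≤m+n (suc o) _)) (perm-> _ r)) ∷ i₂ , cong suc e₂
...   | suc k = s₁ ++ s₂ , ++⁺ s₁⊆ (suc o ∷ʳ s₂⊆) ,
                AllPairs.++⁺ i₁ i₂ (<⇒≺ λ x∈ y∈ → ≺⇒< (lower≺upper o l r) (∈-++⁺ˡ (lookup s₁⊆ x∈)) (lookup s₂⊆ y∈)) ,
                trans (length-++ s₁) (cong₂ _+_ e₁ e₂)

increasing-length≤ : ∀ o t {s} → s ⊆ perm o t → AllPairs _<_ s → length s ≤ lis t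
increasing-length≤ o leaf [] i = z≤n
increasing-length≤ o (node l r) s⊆ i with ⊆-++⁻ (perm (suc o) l) s⊆
... | s₁ , s₂ , refl , p₁ , _ ∷ʳ p₂ with AllPairs-++⁻ s₁ i
...   | i₁ , i₂ , _ = ≤-trans (≤-reflexive (length-++ s₁))
        (+-mono-≤ (≤-trans (increasing-length≤ (suc o) l p₁ i₁) (m≤n⊔m 1 _)) (increasing-length≤ _ r p₂ i₂))
increasing-length≤ o (node l r) s⊆ i | [] , _ ∷ s₂ , refl , p₁ , refl ∷ p₂ =
  +-mono-≤ (m≤m⊔n 1 (lis l)) (increasing-length≤ _ r p₂ (AllPairs.tail i))
-- No increasing subsequence uses both the root entry and an entry of the left subtree, because the
-- latter is larger and stands earlier.
increasing-length≤ o (node l r) s⊆ i | x ∷ s₁ , _ ∷ s₂ , refl , p₁ , refl ∷ p₂ with i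
... | x< ∷ _ = ⊥-elim (<-asym (All.lookup x< (∈-++⁺ʳ s₁ (here refl)))
                              (All.lookup (perm-> (suc o) l) (lookup p₁ (here refl))))

LIS-perm : ∀ o t → LIS (perm o t) ≡ lis t
LIS-perm o t = LIS-≡ (longest o t) (increasing-length≤ o t)

-- The pattern 312 is not a direct sum of two nonempty pieces and does not end with its minimum, so
-- an occurrence in a node would lie entirely in one subtree.
tree-avoids-312 : ∀ t → ¬ TreeContains t pat312
tree-avoids-312 (node l r) ([] , _ , refl , _ , _ , c) = tree-avoids-312 r c
tree-avoids-312 (node l r) (_ ∷ [] , _ , refl , ((s≤s () ∷ _) ∷ _) , _)
tree-avoids-312 (node l r) (_ ∷ _ ∷ [] , _ , refl , ((s≤s (s≤s ()) ∷ _) ∷ _) , _)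
tree-avoids-312 (node l r) (_ ∷ _ ∷ _ ∷ [] , [] , refl , _ , inj₁ c , _) = tree-avoids-312 l c
tree-avoids-312 (node l r) (_ ∷ _ ∷ _ ∷ [] , [] , refl , _ , inj₂ (_ ∷ _ ∷ [] , _ , refl , (_ ∷ s≤s () ∷ []) , _) , _)
tree-avoids-312 (node l r) (_ ∷ _ ∷ _ ∷ [] , [] , refl , _ , inj₂ (_ ∷ _ ∷ _ ∷ [] , _ , () , _) , _)
tree-avoids-312 (node l r) (_ ∷ _ ∷ _ ∷ [] , [] , refl , _ , inj₂ (_ ∷ _ ∷ _ ∷ _ ∷ _ , _ , () , _) , _)

perm-avoids-312 : ∀ t → avoidsB (perm 0 t) pat312 ≡ true
perm-avoids-312 t = cong not (≢true⇒≡false (tree-avoids-312 t ∘ contains⇒tree 0 t ∘ containsB⇒Contains))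

-- Every 312-avoider comes from exactly one tree

avoidsB⇒¬Contains : ∀ {σ π} → avoidsB σ π ≡ true → ¬ Contains σ π
avoidsB⇒¬Contains e c with () ← trans (sym (cong not (Contains⇒containsB c))) e

312⇒Contains : ∀ {σ x o y} → x ∷ o ∷ y ∷ [] ⊆ σ → o < y → y < x → Contains σ pat312
312⇒Contains {σ} {x} {o} {y} sub o<y y<x = (x , 3) ∷ (o , 1) ∷ (y , 2) ∷ [] , sub , refl , coh
  where
  both-< : ∀ {a b c d} → a < b → c < d → a < b ⇔ c < d
  both-< p q = mk⇔ (λ _ → q) (λ _ → p)
  both-≥ : ∀ {a b c d} → b < a → d < c → a < b ⇔ c < d
  both-≥ p q = mk⇔ (⊥-elim ∘ <-asym p) (⊥-elim ∘ <-asym q)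
  irrefl : ∀ {a c} → a < a ⇔ c < c
  irrefl = mk⇔ (⊥-elim ∘ <-irrefl refl) (⊥-elim ∘ <-irrefl refl)
  1<2 = s≤s (s≤s z≤n)
  2<3 = s≤s (s≤s (s≤s z≤n))
  1<3 = s≤s (s≤s z≤n)
  coh : Coherent _
  coh (here refl) (here refl) = irrefl
  coh (here refl) (there (here refl)) = both-≥ (<-trans o<y y<x) 1<3
  coh (here refl) (there (there (here refl))) = both-≥ y<x 2<3
  coh (there (here refl)) (here refl) = both-< (<-trans o<y y<x) 1<3
  coh (there (here refl)) (there (here refl)) = irrefl
  coh (there (here refl)) (there (there (here refl))) = both-< o<y 1<2
  coh (there (there (here refl))) (here refl) = both-< y<x 2<3
  coh (there (there (here refl))) (there (here refl)) = both-≥ o<y 1<2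
  coh (there (there (here refl))) (there (there (here refl))) = irrefl

∈∈⇒⊆ : ∀ {A : Set} {x o y : A} {α β} → x ∈ α → y ∈ β → x ∷ o ∷ y ∷ [] ⊆ α ++ o ∷ β
∈∈⇒⊆ {β = β} x∈ y∈ = ++⁺ (from∈ x∈) (refl ∷ from∈ y∈)

range : ℕ → ℕ → List ℕ
range o zero = []
range o (suc n) = suc o ∷ range (suc o) n

range-++ : ∀ o a b → range o (a + b) ≡ range o a ++ range (o + a) b
range-++ o zero b = cong (λ o → range o b) (sym (+-identityʳ o))
range-++ o (suc a) b = cong (suc o ∷_) (trans (range-++ (suc o) a b)
  (cong (λ c → range (suc o) a ++ range c b) (sym (+-suc o a))))

applyUpTo-range : ∀ o n f → (∀ i → f i ≡ suc (o + i)) → applyUpTo f n ≡ range o n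
applyUpTo-range o zero f h = refl
applyUpTo-range o (suc n) f h = cong₂ _∷_ (trans (h 0) (cong suc (+-identityʳ o)))
  (applyUpTo-range (suc o) n (f ∘ suc) (λ i → trans (h (suc i)) (cong suc (+-suc o i))))

oneTo-range : ∀ n → oneTo n ≡ range 0 n
oneTo-range n = trans (map-upTo suc n) (applyUpTo-range 0 n suc (λ _ → refl))

∈-range : ∀ o n {x} → x ∈ range o n → o < x × x ≤ o + n
∈-range o (suc n) (here refl) = ≤-refl , subst (suc o ≤_) (sym (+-suc o n)) (s≤s (m≤m+n o n))
∈-range o (suc n) {x} (there x∈) with ∈-range (suc o) n x∈
... | lo , hi = <⇒≤ lo , subst (x ≤_) (sym (+-suc o n)) hi

range-unique : ∀ o n → Unique (range o n)
range-unique o zero = []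
range-unique o (suc n) = All.tabulate (λ x∈ → <⇒≢ (proj₁ (∈-range (suc o) n x∈))) ∷ range-unique (suc o) n

Unique-↭ : ∀ {xs ys : List ℕ} → xs ↭ ys → Unique xs → Unique ys
Unique-↭ p = ↭ₛ.Unique-resp-↭ (setoid ℕ) (↭⇒↭ₛ p)

perm-↭ : ∀ o t → perm o t ↭ range o (size t)
perm-↭ o leaf = ↭-refl
perm-↭ o (node l r) = ↭-trans (↭.shift (suc o) (perm (suc o) l) _)
  (↭-prep (suc o) (↭-trans (↭.++⁺ (perm-↭ (suc o) l) (perm-↭ (suc o + size l) r))
    (↭-reflexive (sym (range-++ (suc o) (size l) (size r))))))

-- If `α` is nonempty it must contain the least entry `suc o`, since `α` lies below `β`. Deleting
-- this entry leaves the same situation on a shorter interval, so both parts fill intervals.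
≺-↭-range : ∀ o n α {β} → α ≺ β → α ++ β ↭ range o n →
            ∃₂ λ a b → a + b ≡ n × α ↭ range o a × β ↭ range (o + a) b
≺-↭-range o n [] α≺β p = 0 , n , refl , ↭-refl , subst (λ c → _ ↭ range c n) (sym (+-identityʳ o)) p
≺-↭-range o zero (x ∷ α) α≺β p = ⊥-elim (↭.¬x∷xs↭[] p)
≺-↭-range o (suc n) (x ∷ α) {β} α≺β p with ∈-++⁻ (x ∷ α) (↭.∈-resp-↭ (↭-sym p) (here refl))
... | inj₂ o∈β = ⊥-elim (<⇒≱ (≺⇒< α≺β (here refl) o∈β) (proj₁ (∈-range o (suc n) (↭.∈-resp-↭ p (here refl)))))
... | inj₁ o∈α with ∈-∃++ o∈α
...   | u , v , eq with subst (_≺ β) eq α≺β | subst (λ α → α ++ β ↭ range o (suc n)) eq p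
...     | α≺β′ | p′ with ≺-↭-range (suc o) n (u ++ v) {β}
                           (All.++⁺ (All.++⁻ˡ u α≺β′) (All.tail (All.++⁻ʳ u α≺β′)))
                           (↭.drop-∷ (↭-trans (↭-sym (↭.++⁺ʳ β (↭.shift (suc o) u v))) p′))
...       | a , b , e , q₁ , q₂ = suc a , b , cong suc e ,
                                  ↭-trans (↭-reflexive eq) (↭-trans (↭.shift (suc o) u v) (↭-prep (suc o) q₁)) ,
                                  subst (λ c → β ↭ range c b) (sym (+-suc o a)) q₂

-- `σ` is cut at its least entry: an entry of the left part above one of the right part would form a
-- 312 with it. The two parts are not structurally smaller than `σ`, so `f` bounds the recursion.
perm-surjective : ∀ f {n} o σ → n ≤ f → σ ↭ range o n → ¬ Contains σ pat312 →
                  ∃ λ t → size t ≡ n × perm o t ≡ σ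
perm-surjective f {zero} o σ n≤f p av = leaf , refl , sym (↭.↭-empty-inv p)
perm-surjective (suc f) {suc n} o σ (s≤s n≤f) p av with ∈-∃++ (↭.∈-resp-↭ (↭-sym p) (here refl))
... | α , β , refl = build
  where
  q : α ++ β ↭ range (suc o) n
  q = ↭.drop-∷ (↭-trans (↭-sym (↭.shift (suc o) α β)) p)
  distinct : ∀ {x y} → x ∈ α → y ∈ β → x ≢ y
  distinct = proj₂ (proj₂ (AllPairs-++⁻ α (Unique-↭ (↭-sym q) (range-unique (suc o) n))))
  α≺β : α ≺ β
  α≺β = <⇒≺ λ x∈ y∈ → ≰⇒> λ y≤x → av (312⇒Contains (∈∈⇒⊆ x∈ y∈)
    (proj₁ (∈-range (suc o) n (↭.∈-resp-↭ q (∈-++⁺ʳ α y∈))))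
    (≤∧≢⇒< y≤x (λ e → distinct x∈ y∈ (sym e))))
  build : ∃ λ t → size t ≡ suc n × perm o t ≡ α ++ suc o ∷ β
  build with ≺-↭-range (suc o) n α α≺β q
  ... | a , b , refl , q₁ , q₂
    with perm-surjective f (suc o) α (≤-trans (m≤m+n a b) n≤f) q₁ (av ∘ contains-⊆ˡ (++⁺ʳ _ ⊆-refl))
       | perm-surjective f (suc o + a) β (≤-trans (m≤n+m b a) n≤f) q₂
           (av ∘ contains-⊆ˡ (++⁺ˡ α (suc o ∷ʳ ⊆-refl)))
  ...   | l , refl , refl | r , refl , refl = node l r , refl , refl

++-∷-cancel : ∀ {A : Set} {x : A} α α′ {β β′} → x ∉ α → x ∉ α′ → α ++ x ∷ β ≡ α′ ++ x ∷ β′ → α ≡ α′ × β ≡ β′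
++-∷-cancel [] [] _ _ e = refl , proj₂ (∷-injective e)
++-∷-cancel [] (y ∷ α′) _ x∉ e = ⊥-elim (x∉ (here (proj₁ (∷-injective e))))
++-∷-cancel (y ∷ α) [] x∉ _ e = ⊥-elim (x∉ (here (sym (proj₁ (∷-injective e)))))
++-∷-cancel (y ∷ α) (y′ ∷ α′) x∉ x∉′ e with ∷-injective e
... | refl , e′ with ++-∷-cancel α α′ (x∉ ∘ there) (x∉′ ∘ there) e′
...   | refl , refl = refl , refl

perm-injective : ∀ o {t t′} → perm o t ≡ perm o t′ → t ≡ t′
perm-injective o {leaf} {leaf} e = refl
perm-injective o {leaf} {node l r} e with () ← ++-conicalʳ (perm (suc o) l) _ (sym e)
perm-injective o {node l r} {leaf} e with () ← ++-conicalʳ (perm (suc o) l) _ e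
perm-injective o {node l r} {node l′ r′} e
  with ++-∷-cancel (perm (suc o) l) (perm (suc o) l′) (below l) (below l′) e
  where
  below : ∀ t → suc o ∉ perm (suc o) t
  below t o∈ = <-irrefl refl (All.lookup (perm-> (suc o) t) o∈)
... | e₁ , e₂ with perm-injective (suc o) {l} {l′} e₁
...   | refl with perm-injective (suc o + size l) {r} {r′} e₂
...     | refl = refl

-- Enumerating permutations and trees without repetition

∈-insertions⁺ : ∀ x α β → α ++ x ∷ β ∈ insertions x (α ++ β)
∈-insertions⁺ x [] [] = here refl
∈-insertions⁺ x [] (y ∷ β) = here refl
∈-insertions⁺ x (y ∷ α) β = there (∈-map⁺ (y ∷_) (∈-insertions⁺ x α β))

∈-insertions⁻ : ∀ x w {σ} → σ ∈ insertions x w → ∃₂ λ α β → w ≡ α ++ β × σ ≡ α ++ x ∷ β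
∈-insertions⁻ x [] (here refl) = [] , [] , refl , refl
∈-insertions⁻ x (y ∷ w) (here refl) = [] , y ∷ w , refl , refl
∈-insertions⁻ x (y ∷ w) (there σ∈) with ∈-map⁻ (y ∷_) σ∈
... | _ , p , refl with ∈-insertions⁻ x w p
...   | α , β , refl , refl = y ∷ α , β , refl , refl

oneTo-suc-↭ : ∀ n → oneTo (suc n) ↭ suc n ∷ oneTo n
oneTo-suc-↭ n = ↭-trans (↭-reflexive (trans (cong (map suc) (sym (upTo-∷ʳ n))) (map-++ suc (upTo n) _)))
  (↭-sym (↭.∷↭∷ʳ (suc n) (oneTo n)))

∈-perms⁻ : ∀ n {σ} → σ ∈ perms n → σ ↭ oneTo n
∈-perms⁻ zero (here refl) = ↭-refl
∈-perms⁻ (suc n) σ∈ with find (∈-concatMap⁻ (insertions (suc n)) {xs = perms n} σ∈)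
... | w , w∈ , p with ∈-insertions⁻ (suc n) w p
...   | α , β , refl , refl = ↭-trans (↭.shift (suc n) α β)
                                (↭-trans (↭-prep (suc n) (∈-perms⁻ n w∈)) (↭-sym (oneTo-suc-↭ n)))

∈-perms⁺ : ∀ n {σ} → σ ↭ oneTo n → σ ∈ perms n
∈-perms⁺ zero p rewrite ↭.↭-empty-inv p = here refl
∈-perms⁺ (suc n) p with ∈-∃++ (↭.∈-resp-↭ (↭-sym (↭-trans p (oneTo-suc-↭ n))) (here refl))
... | α , β , refl = ∈-concatMap⁺ (insertions (suc n)) {xs = perms n}
  (lose (∈-perms⁺ n (↭.drop-∷ (↭-trans (↭-sym (↭.shift (suc n) α β)) (↭-trans p (oneTo-suc-↭ n)))))
        (∈-insertions⁺ (suc n) α β))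

max∉perms : ∀ n {w} → w ∈ perms n → suc n ∉ w
max∉perms n w∈ x∈ with ∈-range 0 n (subst (suc n ∈_) (oneTo-range n) (↭.∈-resp-↭ (∈-perms⁻ n w∈) x∈))
... | _ , n<n = <-irrefl refl n<n

insertions-unique : ∀ x w → x ∉ w → Unique (insertions x w)
insertions-unique x [] x∉ = [] ∷ []
insertions-unique x (y ∷ w) x∉ =
  All.map⁺ (All.tabulate λ _ e → x∉ (here (proj₁ (∷-injective e)))) ∷
  Unique.map⁺ (proj₂ ∘ ∷-injective) (insertions-unique x w (x∉ ∘ there))

insertions-disjoint : ∀ {x w w′ σ} → x ∉ w → x ∉ w′ → σ ∈ insertions x w → σ ∈ insertions x w′ → w ≡ w′
insertions-disjoint {x} {w} {w′} x∉ x∉′ p p′ with ∈-insertions⁻ x w p | ∈-insertions⁻ x w′ p′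
... | α , β , refl , refl | α′ , β′ , refl , e
  with ++-∷-cancel α α′ (x∉ ∘ ∈-++⁺ˡ) (x∉′ ∘ ∈-++⁺ˡ) e
... | refl , refl = refl

concatMap-unique : ∀ {A B : Set} (f : A → List B) {xs} → Unique xs → (∀ {x} → x ∈ xs → Unique (f x)) →
  (∀ {x y z} → x ∈ xs → y ∈ xs → z ∈ f x → z ∈ f y → x ≡ y) → Unique (concatMap f xs)
concatMap-unique f [] u d = []
concatMap-unique f {x ∷ xs} (x∉ ∷ uxs) u d = Unique.++⁺ (u (here refl))
  (concatMap-unique f uxs (u ∘ there) (λ x∈ y∈ → d (there x∈) (there y∈)))
  λ (p , q) → case find (∈-concatMap⁻ f {xs = xs} q) of λ (y , y∈ , q′) →
    All.lookup x∉ y∈ (d (here refl) (there y∈) p q′)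

perms-unique : ∀ n → Unique (perms n)
perms-unique zero = [] ∷ []
perms-unique (suc n) = concatMap-unique (insertions (suc n)) (perms-unique n)
  (λ w∈ → insertions-unique (suc n) _ (max∉perms n w∈))
  (λ w∈ w∈′ → insertions-disjoint (max∉perms n w∈) (max∉perms n w∈′))

-- The first argument is a recursion bound; trees n below takes it large enough.
treesUpTo : ℕ → ℕ → List Tree
treesUpTo zero n = []
treesUpTo (suc f) zero = leaf ∷ []
treesUpTo (suc f) (suc n) =
  concatMap (λ i → cartesianProductWith node (treesUpTo f i) (treesUpTo f (n ∸ i))) (upTo (suc n))

trees : ℕ → List Tree
trees n = treesUpTo (suc n) n

treesUpTo-stable : ∀ f g n → n < f → n < g → treesUpTo f n ≡ treesUpTo g n
treesUpTo-stable (suc f) (suc g) zero _ _ = refl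
treesUpTo-stable (suc f) (suc g) (suc n) (s≤s n<f) (s≤s n<g) =
  cong concat (map-cong-local (All.tabulate λ {i} i∈ →
    cong₂ (cartesianProductWith node)
      (treesUpTo-stable f g i (≤-<-trans (s≤s⁻¹ (∈-upTo⁻ i∈)) n<f) (≤-<-trans (s≤s⁻¹ (∈-upTo⁻ i∈)) n<g))
      (treesUpTo-stable f g (n ∸ i) (≤-<-trans (m∸n≤m n i) n<f) (≤-<-trans (m∸n≤m n i) n<g))))

trees-suc : ∀ n → trees (suc n) ≡
  concatMap (λ i → cartesianProductWith node (trees i) (trees (n ∸ i))) (upTo (suc n))
trees-suc n = cong concat (map-cong-local (All.tabulate λ {i} i∈ →
    cong₂ (cartesianProductWith node)
      (treesUpTo-stable (suc n) (suc i) i (∈-upTo⁻ i∈) ≤-refl)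
      (treesUpTo-stable (suc n) (suc (n ∸ i)) (n ∸ i) (s≤s (m∸n≤m n i)) ≤-refl)))

∈-treesUpTo⁻ : ∀ f n {t} → t ∈ treesUpTo f n → size t ≡ n
∈-treesUpTo⁻ (suc f) zero (here refl) = refl
∈-treesUpTo⁻ (suc f) (suc n) t∈ with find (∈-concatMap⁻ _ {xs = upTo (suc n)} t∈)
... | i , i∈ , p with ∈-cartesianProductWith⁻ node (treesUpTo f i) (treesUpTo f (n ∸ i)) p
...   | l , r , l∈ , r∈ , refl = cong suc (trans (cong₂ _+_ (∈-treesUpTo⁻ f i l∈) (∈-treesUpTo⁻ f (n ∸ i) r∈))
                                   (m+[n∸m]≡n (s≤s⁻¹ (∈-upTo⁻ i∈))))

∈-treesUpTo⁺ : ∀ f t → size t < f → t ∈ treesUpTo f (size t)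
∈-treesUpTo⁺ (suc f) leaf _ = here refl
∈-treesUpTo⁺ (suc f) (node l r) (s≤s s<f) = ∈-concatMap⁺ _ {xs = upTo (suc (size l + size r))}
  (lose (∈-upTo⁺ (s≤s (m≤m+n (size l) (size r))))
    (∈-cartesianProductWith⁺ node (∈-treesUpTo⁺ f l (≤-<-trans (m≤m+n _ _) s<f))
      (subst (λ k → r ∈ treesUpTo f k) (sym (m+n∸m≡n (size l) (size r)))
        (∈-treesUpTo⁺ f r (≤-<-trans (m≤n+m _ _) s<f)))))

node-injective : ∀ {l r l′ r′} → node l r ≡ node l′ r′ → l ≡ l′ × r ≡ r′
node-injective refl = refl , refl

treesUpTo-unique : ∀ f n → Unique (treesUpTo f n)
treesUpTo-unique zero n = []
treesUpTo-unique (suc f) zero = [] ∷ []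
treesUpTo-unique (suc f) (suc n) = concatMap-unique _ (Unique.upTo⁺ (suc n))
  (λ {i} _ → Unique.cartesianProductWith⁺ node node-injective (treesUpTo-unique f i) (treesUpTo-unique f (n ∸ i)))
  λ {i} {j} _ _ p q → disj i j p q
  where
  disj : ∀ i j {t} → t ∈ cartesianProductWith node (treesUpTo f i) (treesUpTo f (n ∸ i)) →
         t ∈ cartesianProductWith node (treesUpTo f j) (treesUpTo f (n ∸ j)) → i ≡ j
  disj i j p q with ∈-cartesianProductWith⁻ node (treesUpTo f i) _ p | ∈-cartesianProductWith⁻ node (treesUpTo f j) _ q
  ... | l , r , l∈ , _ , refl | l , r , l∈′ , _ , refl = trans (sym (∈-treesUpTo⁻ f i l∈)) (∈-treesUpTo⁻ f j l∈′)

-- Both lists are free of repetitions and have the same members, so they are rearrangements of each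
-- other, which is all that sums can detect.
avoiders-↭ : ∀ n → filter (λ σ → avoidsB σ pat312 Bool.≟ true) (perms n) ↭ map (perm 0) (trees n)
avoiders-↭ n = ∼bag⇒↭ (unique∧set⇒bag
  (Unique.filter⁺ av? (perms-unique n))
  (Unique.map⁺ (perm-injective 0) (treesUpTo-unique (suc n) n))
  (mk⇔ fwd bwd))
  where
  av? = λ σ → avoidsB σ pat312 Bool.≟ true
  fwd : ∀ {σ} → σ ∈ filter av? (perms n) → σ ∈ map (perm 0) (trees n)
  fwd {σ} σ∈ with ∈-filter⁻ av? {xs = perms n} σ∈
  ... | σ∈′ , av with perm-surjective n 0 σ ≤-refl (subst (σ ↭_) (oneTo-range n) (∈-perms⁻ n σ∈′)) (avoidsB⇒¬Contains av)
  ...   | t , refl , refl = ∈-map⁺ (perm 0) (∈-treesUpTo⁺ (suc n) t ≤-refl)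
  bwd : ∀ {σ} → σ ∈ map (perm 0) (trees n) → σ ∈ filter av? (perms n)
  bwd σ∈ with ∈-map⁻ (perm 0) σ∈
  ... | t , t∈ , refl = ∈-filter⁺ av?
    (∈-perms⁺ n (subst (perm 0 t ↭_) (trans (cong (range 0) (∈-treesUpTo⁻ (suc n) n t∈)) (sym (oneTo-range n))) (perm-↭ 0 t)))
    (perm-avoids-312 t)

-- The normal form and containment in a node

Block : List ℕ → Set
Block = SkewMin (λ _ → ⊤)

-- The last entries of the blocks are then exactly the right-to-left minima of the concatenation:
-- each is the minimum of its own block and lies below all later blocks.
NormalForm : List (List ℕ) → Set
NormalForm bs = All Block bs × AllPairs _≺_ bs

snoc≢[] : ∀ {A : Set} (u : List A) {m} → u ++ m ∷ [] ≢ []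
snoc≢[] u e with () ← ++-conicalʳ u _ e

block≢[] : ∀ {b} → Block b → b ≢ []
block≢[] (u , m , refl , _) = snoc≢[] u

concat-take≢[] : ∀ {j} bs → 0 < length bs → All Block bs → concat (take (suc j) bs) ≢ []
concat-take≢[] (b ∷ _) _ (B ∷ _) e = block≢[] B (++-conicalˡ b _ e)

-- A block ends with its minimum, so it is not a direct sum of two nonempty sequences.
block-indecomposable : ∀ {P w} w₁ {w₂} → SkewMin P w → w ≡ w₁ ++ w₂ → w₁ ≺ w₂ → w₁ ≡ [] ⊎ w₂ ≡ []
block-indecomposable [] _ _ _ = inj₁ refl
block-indecomposable (x ∷ w₁) {w₂} (u , m , e₁ , m< , _) e₂ w≺ with initLast w₂
... | [] = inj₂ refl
... | v ∷ʳ′ y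
  with ∷ʳ-injective u (x ∷ w₁ ++ v) (trans (sym e₁) (trans e₂ (sym (++-assoc (x ∷ w₁) v _))))
...   | refl , refl = ⊥-elim (<-asym (All.head m<) (≺⇒< w≺ (here refl) (∈-++⁺ʳ v (here refl))))

++-overlap : ∀ {A : Set} (a c : List A) {b d} → a ++ b ≡ c ++ d →
             (∃ λ e → c ≡ a ++ e × b ≡ e ++ d) ⊎ (∃ λ e → a ≡ c ++ e × d ≡ e ++ b)
++-overlap [] c eq = inj₁ (c , refl , eq)
++-overlap (x ∷ a) [] eq = inj₂ (x ∷ a , refl , sym eq)
++-overlap (x ∷ a) (y ∷ c) eq with ∷-injective eq
... | refl , eq′ with ++-overlap a c eq′
...   | inj₁ (e , p , q) = inj₁ (e , cong (x ∷_) p , q)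
...   | inj₂ (e , p , q) = inj₂ (e , cong (x ∷_) p , q)

-- A direct-sum cut strictly inside a block would decompose that block, so every cut falls between
-- two blocks or at an end.
concat-split : ∀ bs w₁ {w₂} → All Block bs → concat bs ≡ w₁ ++ w₂ → w₁ ≺ w₂ →
               ∃ λ j → j ≤ length bs × w₁ ≡ concat (take j bs) × w₂ ≡ concat (drop j bs)
concat-split [] w₁ {w₂} _ e _ = 0 , z≤n , ++-conicalˡ w₁ w₂ (sym e) , ++-conicalʳ w₁ w₂ (sym e)
concat-split (b ∷ bs) w₁ (B ∷ Bs) eq w≺ with ++-overlap b w₁ eq
... | inj₁ (e , refl , p) with concat-split bs e Bs p (All.++⁻ʳ b w≺)
...   | j , j≤ , p₁ , p₂ = suc j , s≤s j≤ , cong (b ++_) p₁ , p₂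
concat-split (b ∷ bs) w₁ (B ∷ Bs) eq w≺ | inj₂ (e , p , refl)
  with block-indecomposable w₁ B p (All.map (All.++⁻ˡ e) w≺)
...   | inj₁ refl = 0 , z≤n , refl , cong (_++ concat bs) (sym p)
...   | inj₂ refl = 1 , s≤s z≤n , trans (sym (++-identityʳ w₁)) (trans (sym p) (sym (++-identityʳ b))) , refl

concat-take-drop : ∀ (bs : List (List ℕ)) j → concat bs ≡ concat (take j bs) ++ concat (drop j bs)
concat-take-drop bs j = trans (cong concat (sym (take++drop≡id j bs))) (sym (concat-++ (take j bs) (drop j bs)))

take≺drop : ∀ bs j → AllPairs _≺_ bs → concat (take j bs) ≺ concat (drop j bs)
take≺drop bs j ps = <⇒≺ lt
  where
  lt : ∀ {x y} → x ∈ concat (take j bs) → y ∈ concat (drop j bs) → x < y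
  lt x∈ y∈ with ∈-concat⁻′ (take j bs) x∈ | ∈-concat⁻′ (drop j bs) y∈
  ... | _ , x∈b , b∈ | _ , y∈b′ , b′∈ =
    ≺⇒< (proj₂ (proj₂ (AllPairs-++⁻ (take j bs) (subst (AllPairs _≺_) (sym (take++drop≡id j bs)) ps))) b∈ b′∈) x∈b y∈b′

-- The computed blocks are in normal form

false≢true : false ≢ true
false≢true ()

allGreater-true : ∀ {x} ys → allGreater x ys ≡ true → All (x <_) ys
allGreater-true [] e = []
allGreater-true {x} (y ∷ ys) e = <ᵇ-true⁻ (proj₁ (∧-true e)) ∷ allGreater-true ys (proj₂ (∧-true {x <ᵇ y} e))

allGreater-false : ∀ {x} ys → x ∉ ys → allGreater x ys ≡ false → ∃ λ z → z ∈ ys × z < x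
allGreater-false {x} (y ∷ ys) x∉ e with x <ᵇ y in x<ᵇy
... | true with allGreater-false ys (x∉ ∘ there) e
...   | z , z∈ , z<x = z , there z∈ , z<x
allGreater-false {x} (y ∷ ys) x∉ e | false = y , here refl ,
  ≤∧≢⇒< (≮⇒≥ λ x<y → false≢true (trans (sym x<ᵇy) (<ᵇ-true x<y))) (λ y≡x → x∉ (here (sym y≡x)))

reverse-∷-++ : ∀ {A : Set} x (acc rest : List A) → reverse (x ∷ acc) ++ rest ≡ reverse acc ++ x ∷ rest
reverse-∷-++ x acc rest = trans (cong (_++ rest) (unfold-reverse x acc)) (++-assoc (reverse acc) _ rest)

-- The invariant is that every pending entry still has a smaller entry to come. Hence the next
-- right-to-left minimum lies below all of `acc`, and `acc` is empty when the input ends. A pending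
-- entry above one that follows this minimum would be the 3 of a 312, so consecutive blocks
-- increase.
blocksAux-normal : ∀ acc rest → Unique (reverse acc ++ rest) → ¬ Contains (reverse acc ++ rest) pat312 →
  (∀ {y} → y ∈ acc → ∃ λ z → z ∈ rest × z < y) →
  NormalForm (blocksAux acc rest) × concat (blocksAux acc rest) ≡ reverse acc ++ rest
blocksAux-normal [] [] _ _ _ = ([] , []) , refl
blocksAux-normal (y ∷ acc) [] _ _ wit with () ← proj₁ (proj₂ (wit (here refl)))
blocksAux-normal acc (x ∷ rest) uniq av wit with AllPairs-++⁻ (reverse acc) uniq
... | _ , x∉rest ∷ uniq-rest , distinct with allGreater x rest in g
...   | false with blocksAux-normal (x ∷ acc) rest
                     (subst Unique (sym (reverse-∷-++ x acc rest)) uniq)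
                     (av ∘ subst (λ σ → Contains σ pat312) (reverse-∷-++ x acc rest)) wit′
  where
  smaller = allGreater-false rest (λ x∈ → All.lookup x∉rest x∈ refl) g
  wit′ : ∀ {y} → y ∈ x ∷ acc → ∃ λ z → z ∈ rest × z < y
  wit′ (here refl) = smaller
  wit′ (there y∈) with wit y∈
  ... | z , there z∈ , z<y = z , z∈ , z<y
  ... | z , here refl , x<y = proj₁ smaller , proj₁ (proj₂ smaller) , <-trans (proj₂ (proj₂ smaller)) x<y
...     | nf , e = nf , trans e (reverse-∷-++ x acc rest)
blocksAux-normal acc (x ∷ rest) uniq av wit | _ , x∉rest ∷ uniq-rest , distinct | true
  with blocksAux-normal [] rest uniq-rest (av ∘ contains-⊆ˡ (++⁺ˡ (reverse acc) (x ∷ʳ ⊆-refl))) (λ ())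
... | (Bs , ps) , e =
  ((reverse acc , x , unfold-reverse x acc , All.tabulate (λ y∈ → x<acc (Any.reverse⁻ y∈)) , tt) ∷ Bs ,
   All.tabulate (λ b∈ → <⇒≺ λ y∈ z∈ → lt y∈ (subst (_ ∈_) e (∈-concat⁺′ z∈ b∈))) ∷ ps) ,
  trans (cong (reverse (x ∷ acc) ++_) e) (reverse-∷-++ x acc rest)
  where
  x<rest = allGreater-true rest g
  x<acc : ∀ {y} → y ∈ acc → x < y
  x<acc y∈ with wit y∈
  ... | z , here refl , z<y = z<y
  ... | z , there z∈ , z<y = <-trans (All.lookup x<rest z∈) z<y
  lt : ∀ {y z} → y ∈ reverse (x ∷ acc) → z ∈ rest → y < z
  lt y∈ z∈ with ∈-++⁻ (reverse acc) (subst (_ ∈_) (unfold-reverse x acc) y∈)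
  ... | inj₂ (here refl) = All.lookup x<rest z∈
  ... | inj₁ y∈acc = ≰⇒> λ z≤y → av (312⇒Contains (∈∈⇒⊆ y∈acc z∈) (All.lookup x<rest z∈)
          (≤∧≢⇒< z≤y (λ z≡y → distinct y∈acc (there z∈) (sym z≡y))))

-- Containment in a node through the cuts of the pattern

concat-take-⊆ : ∀ j (bs : List (List ℕ)) → concat (take j bs) ⊆ concat (take (suc j) bs)
concat-take-⊆ zero bs = minimum _
concat-take-⊆ (suc j) [] = []
concat-take-⊆ (suc j) (b ∷ bs) = ++⁺ (⊆-refl {x = b}) (concat-take-⊆ j bs)

concat-drop-⊆ : ∀ j (bs : List (List ℕ)) → concat (drop (suc j) bs) ⊆ concat (drop j bs)
concat-drop-⊆ zero [] = []
concat-drop-⊆ zero (b ∷ bs) = ++⁺ˡ b ⊆-refl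
concat-drop-⊆ (suc j) [] = []
concat-drop-⊆ (suc j) (b ∷ bs) = concat-drop-⊆ j bs

containsᵗ : List ℕ → Tree → Bool
containsᵗ w t = containsB (perm 0 t) w

containsᵗ⇒ : ∀ {w} t → containsᵗ w t ≡ true → TreeContains t w
containsᵗ⇒ t = contains⇒tree 0 t ∘ containsB⇒Contains

⇒containsᵗ : ∀ {w} t → TreeContains t w → containsᵗ w t ≡ true
⇒containsᵗ t = Contains⇒containsB ∘ tree⇒contains 0 t

containsᵗ-⊆ : ∀ {w w′} t → w′ ⊆ w → containsᵗ w t ≡ true → containsᵗ w′ t ≡ true
containsᵗ-⊆ t w′⊆ = ⇒containsᵗ t ∘ tree-⊆ t w′⊆ ∘ containsᵗ⇒ t

-- prefix⊑ u bs l j decides whether the first j blocks occur in (perm l) 1.  Only for j = 1 can the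
-- final 1 take part in the occurrence, hence the special treatment of that index.
prefix⊑ : List ℕ → List (List ℕ) → Tree → ℕ → Bool
prefix⊑ u bs l zero = true
prefix⊑ u bs l (suc zero) = containsᵗ u l
prefix⊑ u bs l (suc (suc j)) = containsᵗ (concat (take (suc (suc j)) bs)) l

suffix⊑ : List (List ℕ) → Tree → ℕ → Bool
suffix⊑ bs r j = containsᵗ (concat (drop j bs)) r

module _ {u m cs} (m<u : All (m <_) u) (nf : NormalForm ((u ++ m ∷ []) ∷ cs)) where
  private
    bs = (u ++ m ∷ []) ∷ cs

  node⇒split : ∀ l r → TreeContains (node l r) (concat bs) →
               ∃ λ j → j ≤ length bs × prefix⊑ u bs l j ≡ true × suffix⊑ bs r j ≡ true
  node⇒split l r (w₁ , w₂ , e , w≺ , cl , cr) with concat-split bs w₁ (proj₁ nf) e w≺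
  ... | j , j≤ , refl , refl = j , j≤ , pre j j≤ cl , ⇒containsᵗ r cr
    where
    pre : ∀ j → j ≤ length bs →
          TreeContains l (concat (take j bs)) ⊎ SkewMin (TreeContains l) (concat (take j bs)) → prefix⊑ u bs l j ≡ true
    pre zero _ _ = refl
    pre (suc zero) _ (inj₁ c) = ⇒containsᵗ l (tree-⊆ l (++⁺ʳ _ (++⁺ʳ _ ⊆-refl)) c)
    pre (suc (suc j)) _ (inj₁ c) = ⇒containsᵗ l c
    pre (suc zero) _ (inj₂ (u′ , m′ , e , _ , c))
      with ∷ʳ-injective u u′ (trans (sym (++-identityʳ _)) e)
    ... | refl , refl = ⇒containsᵗ l c
    -- Two or more blocks form a proper direct sum of the first block and the others, so such a
    -- prefix cannot end with its minimum.
    pre (suc (suc j)) (s≤s 1+j≤) (inj₂ s)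
      with block-indecomposable (u ++ m ∷ []) s refl
             (subst (_≺ concat (take (suc j) cs)) (++-identityʳ (u ++ m ∷ []))
               (take≺drop (take (suc (suc j)) bs) 1 (AllPairs.take⁺ (suc (suc j)) (proj₂ nf))))
    ... | inj₁ e = ⊥-elim (snoc≢[] u e)
    ... | inj₂ e = ⊥-elim (concat-take≢[] cs (≤-trans (s≤s z≤n) 1+j≤) (All.tail (proj₁ nf)) e)

  split⇒node : ∀ l r j → prefix⊑ u bs l j ≡ true → suffix⊑ bs r j ≡ true → TreeContains (node l r) (concat bs)
  split⇒node l r j p s = concat (take j bs) , concat (drop j bs) , concat-take-drop bs j ,
    take≺drop bs j (proj₂ nf) , pre j p , containsᵗ⇒ r s
    where
    pre : ∀ j → prefix⊑ u bs l j ≡ true →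
          TreeContains l (concat (take j bs)) ⊎ SkewMin (TreeContains l) (concat (take j bs))
    pre zero _ = inj₁ (tree-[] l)
    -- The root entry plays the role of `m`, so the left subtree only has to supply `u`.
    pre (suc zero) p = inj₂ (u , m , ++-identityʳ _ , m<u , containsᵗ⇒ l p)
    pre (suc (suc j)) p = inj₁ (containsᵗ⇒ l p)

  prefix⊑-antitone : ∀ l j → prefix⊑ u bs l (suc j) ≡ true → prefix⊑ u bs l j ≡ true
  prefix⊑-antitone l zero _ = refl
  prefix⊑-antitone l (suc zero) = containsᵗ-⊆ l (++⁺ʳ _ (++⁺ʳ _ ⊆-refl))
  prefix⊑-antitone l (suc (suc j)) = containsᵗ-⊆ l (concat-take-⊆ (suc (suc j)) bs)

suffix⊑-monotone : ∀ bs r j → suffix⊑ bs r j ≡ true → suffix⊑ bs r (suc j) ≡ true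
suffix⊑-monotone bs r j = containsᵗ-⊆ r (concat-drop-⊆ j bs)

suffix⊑-length : ∀ bs r → suffix⊑ bs r (length bs) ≡ true
suffix⊑-length [] r = ⇒containsᵗ r (tree-[] r)
suffix⊑-length (b ∷ bs) r = suffix⊑-length bs r

-- Indicators and telescoping

⟦_⟧ : Bool → ℤ
⟦ b ⟧ = if b then 1ℤ else 0ℤ

∑ : ∀ {A : Set} → List A → (A → ℤ) → ℤ
∑ xs f = sumℤ (map f xs)

∑-upTo-suc : ∀ n (f : ℕ → ℤ) → ∑ (upTo (suc n)) f ≡ f 0 +ℤ ∑ (upTo n) (f ∘ suc)
∑-upTo-suc n f = cong (λ xs → f 0 +ℤ sumℤ xs) (trans (map-applyUpTo suc f n) (sym (map-applyUpTo (λ i → i) (f ∘ suc) n)))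

∑-cong : ∀ {A : Set} (xs : List A) {f g : A → ℤ} → (∀ x → f x ≡ g x) → ∑ xs f ≡ ∑ xs g
∑-cong [] h = refl
∑-cong (x ∷ xs) h = cong₂ _+ℤ_ (h x) (∑-cong xs h)

∑-zero : ∀ {A : Set} (xs : List A) {f : A → ℤ} → (∀ x → f x ≡ 0ℤ) → ∑ xs f ≡ 0ℤ
∑-zero [] h = refl
∑-zero (x ∷ xs) h = cong₂ _+ℤ_ (h x) (∑-zero xs h)

meets : (ℕ → Bool) → (ℕ → Bool) → ℕ → Bool
meets c d zero = c 0 ∧ d 0
meets c d (suc R) = (c 0 ∧ d 0) ∨ meets (c ∘ suc) (d ∘ suc) R

meets⁺ : ∀ c d R {j} → j ≤ R → c j ≡ true → d j ≡ true → meets c d R ≡ true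
meets⁺ c d zero z≤n cj dj = cong₂ _∧_ cj dj
meets⁺ c d (suc R) z≤n cj dj rewrite cj | dj = refl
meets⁺ c d (suc R) (s≤s j≤) cj dj with c 0 ∧ d 0
... | true = refl
... | false = meets⁺ (c ∘ suc) (d ∘ suc) R j≤ cj dj

meets⁻ : ∀ c d R → meets c d R ≡ true → ∃ λ j → c j ≡ true × d j ≡ true
meets⁻ c d zero e = 0 , ∧-true e
meets⁻ c d (suc R) e with c 0 ∧ d 0 in e₀
... | true = 0 , ∧-true e₀
... | false with meets⁻ (c ∘ suc) (d ∘ suc) R e
...   | j , cj , dj = suc j , cj , dj

-- If c fails from j + 1 on but holds up to j, then c and d meet exactly when d j holds, so only
-- the j-th summand survives.
meets-telescope : ∀ c d R → c 0 ≡ true → d R ≡ true →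
  (∀ j → c (suc j) ≡ true → c j ≡ true) → (∀ j → d j ≡ true → d (suc j) ≡ true) →
  ⟦ not (meets c d R) ⟧ ≡ ∑ (upTo R) (λ j → (⟦ not (c (suc j)) ⟧ - ⟦ not (c j) ⟧) *ℤ ⟦ not (d j) ⟧)
meets-telescope c d zero c₀ d₀ _ _ rewrite c₀ | d₀ = refl
meets-telescope c d (suc R) c₀ dR c↓ d↑ = trans (step (c 1) refl) (sym (∑-upTo-suc R summand))
  where
  summand : ℕ → ℤ
  summand j = (⟦ not (c (suc j)) ⟧ - ⟦ not (c j) ⟧) *ℤ ⟦ not (d j) ⟧
  meets′ = meets (c ∘ suc) (d ∘ suc) R
  step : ∀ b → c 1 ≡ b → ⟦ not ((c 0 ∧ d 0) ∨ meets′) ⟧ ≡ summand 0 +ℤ ∑ (upTo R) (summand ∘ suc)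
  step true c₁ = trans (cong (⟦_⟧ ∘ not) absorb)
    (trans (meets-telescope (c ∘ suc) (d ∘ suc) R c₁ dR (c↓ ∘ suc) (d↑ ∘ suc))
      (sym (trans (cong (_+ℤ ∑ (upTo R) (summand ∘ suc)) zero₀) (ℤ.+-identityˡ _))))
    where
    zero₀ : summand 0 ≡ 0ℤ
    zero₀ rewrite c₀ | c₁ = refl
    absorb : (c 0 ∧ d 0) ∨ meets′ ≡ meets′
    absorb with d 0 in d₀
    ... | true rewrite c₀ = sym (meets⁺ (c ∘ suc) (d ∘ suc) R z≤n c₁ (d↑ 0 d₀))
    ... | false rewrite c₀ = refl
  step false c₁ = trans lhs (sym (trans (cong (summand 0 +ℤ_) (∑-zero (upTo R) vanish)) (ℤ.+-identityʳ _)))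
    where
    c-false : ∀ j → c (suc j) ≡ false
    c-false zero = c₁
    c-false (suc j) = ≢true⇒≡false λ e → false≢true (trans (sym (c-false j)) (c↓ (suc j) e))
    noMeet : meets′ ≡ false
    noMeet = ≢true⇒≡false λ e → let j , cj , _ = meets⁻ (c ∘ suc) (d ∘ suc) R e in
      false≢true (trans (sym (c-false j)) cj)
    vanish : ∀ j → summand (suc j) ≡ 0ℤ
    vanish j rewrite c-false j | c-false (suc j) = refl
    lhs : ⟦ not ((c 0 ∧ d 0) ∨ meets′) ⟧ ≡ summand 0
    lhs rewrite noMeet | c₀ | c₁ with d 0
    ... | true = refl
    ... | false = refl

av : List ℕ → Tree → ℤ
av w t = ⟦ avoidsB (perm 0 t) w ⟧

-- The cuts run from 0 to `length bs` inclusive, but the last one, whose suffix is empty, has no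
-- summand of its own: that suffix occurs in every tree, which is the hypothesis on `d R` of the
-- telescoping.
av-node : ∀ {u m cs} → All (m <_) u → NormalForm ((u ++ m ∷ []) ∷ cs) → let bs = (u ++ m ∷ []) ∷ cs in
  ∀ l r → av (concat bs) (node l r) ≡
    ∑ (upTo (length bs)) (λ j → (⟦ not (prefix⊑ u bs l (suc j)) ⟧ - ⟦ not (prefix⊑ u bs l j) ⟧) *ℤ av (concat (drop j bs)) r)
av-node {u} {m} {cs} m<u nf l r = trans (cong (⟦_⟧ ∘ not) contains≡)
  (meets-telescope c d R refl (suffix⊑-length bs r) (prefix⊑-antitone m<u nf l) (suffix⊑-monotone bs r))
  where
  bs = (u ++ m ∷ []) ∷ cs
  R = length bs
  c = prefix⊑ u bs l
  d = suffix⊑ bs r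
  bwd : meets c d R ≡ true → containsᵗ (concat bs) (node l r) ≡ true
  bwd e with meets⁻ c d R e
  ... | j , cj , dj = ⇒containsᵗ (node l r) (split⇒node m<u nf l r j cj dj)
  fwd : containsᵗ (concat bs) (node l r) ≡ true → meets c d R ≡ true
  fwd e with node⇒split m<u nf l r (containsᵗ⇒ (node l r) e)
  ... | j , j≤ , cj , dj = meets⁺ c d R j≤ cj dj
  contains≡ : containsᵗ (concat bs) (node l r) ≡ meets c d R
  contains≡ with meets c d R in e
  ... | true = bwd e
  ... | false = ≢true⇒≡false λ e′ → false≢true (trans (sym e) (fwd e′))

-- Formal power series of trees

∑-cong-∈ : ∀ {A : Set} (xs : List A) {f g : A → ℤ} → (∀ {x} → x ∈ xs → f x ≡ g x) → ∑ xs f ≡ ∑ xs g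
∑-cong-∈ [] h = refl
∑-cong-∈ (x ∷ xs) h = cong₂ _+ℤ_ (h (here refl)) (∑-cong-∈ xs (h ∘ there))

∑-+ : ∀ {A : Set} (xs : List A) (f g : A → ℤ) → ∑ xs (λ x → f x +ℤ g x) ≡ ∑ xs f +ℤ ∑ xs g
∑-+ [] f g = refl
∑-+ (x ∷ xs) f g = trans (cong ((f x +ℤ g x) +ℤ_) (∑-+ xs f g)) (interchange (f x) (g x) (∑ xs f) (∑ xs g))
  where
  interchange : ∀ a b c d → (a +ℤ b) +ℤ (c +ℤ d) ≡ (a +ℤ c) +ℤ (b +ℤ d)
  interchange = solve-∀

∑-- : ∀ {A : Set} (xs : List A) (f g : A → ℤ) → ∑ xs (λ x → f x - g x) ≡ ∑ xs f - ∑ xs g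
∑-- [] f g = refl
∑-- (x ∷ xs) f g = trans (cong ((f x - g x) +ℤ_) (∑-- xs f g)) (interchange (f x) (g x) (∑ xs f) (∑ xs g))
  where
  interchange : ∀ a b c d → (a - b) +ℤ (c - d) ≡ (a +ℤ c) - (b +ℤ d)
  interchange = solve-∀

∑-*ˡ : ∀ {A : Set} (xs : List A) c (f : A → ℤ) → c *ℤ ∑ xs f ≡ ∑ xs (λ x → c *ℤ f x)
∑-*ˡ [] c f = ℤ.*-zeroʳ c
∑-*ˡ (x ∷ xs) c f = trans (ℤ.*-distribˡ-+ c (f x) _) (cong (c *ℤ f x +ℤ_) (∑-*ˡ xs c f))

∑-*ʳ : ∀ {A : Set} (xs : List A) c (f : A → ℤ) → ∑ xs f *ℤ c ≡ ∑ xs (λ x → f x *ℤ c)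
∑-*ʳ xs c f = trans (ℤ.*-comm _ c) (trans (∑-*ˡ xs c f) (∑-cong xs (λ x → ℤ.*-comm c (f x))))

∑-swap : ∀ {A B : Set} (xs : List A) (ys : List B) (f : A → B → ℤ) →
         ∑ xs (λ x → ∑ ys (f x)) ≡ ∑ ys (λ y → ∑ xs (λ x → f x y))
∑-swap [] ys f = sym (∑-zero ys (λ _ → refl))
∑-swap (x ∷ xs) ys f = trans (cong (∑ ys (f x) +ℤ_) (∑-swap xs ys f)) (sym (∑-+ ys (f x) _))

∑-++ : ∀ {A : Set} (xs ys : List A) (f : A → ℤ) → ∑ (xs ++ ys) f ≡ ∑ xs f +ℤ ∑ ys f
∑-++ [] ys f = sym (ℤ.+-identityˡ _)
∑-++ (x ∷ xs) ys f = trans (cong (f x +ℤ_) (∑-++ xs ys f)) (sym (ℤ.+-assoc (f x) _ _))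

∑-map : ∀ {A B : Set} (g : A → B) xs (f : B → ℤ) → ∑ (map g xs) f ≡ ∑ xs (f ∘ g)
∑-map g xs f = cong sumℤ (sym (map-∘ xs))

∑-concatMap : ∀ {A B : Set} (g : A → List B) xs (f : B → ℤ) → ∑ (concatMap g xs) f ≡ ∑ xs (λ x → ∑ (g x) f)
∑-concatMap g [] f = refl
∑-concatMap g (x ∷ xs) f = trans (∑-++ (g x) _ f) (cong (∑ (g x) f +ℤ_) (∑-concatMap g xs f))

∑-cartesianProductWith : ∀ {A B C : Set} (g : A → B → C) xs ys (f : C → ℤ) →
  ∑ (cartesianProductWith g xs ys) f ≡ ∑ xs (λ x → ∑ ys (λ y → f (g x y)))
∑-cartesianProductWith g [] ys f = refl
∑-cartesianProductWith g (x ∷ xs) ys f =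
  trans (∑-++ (map (g x) ys) _ f) (cong₂ _+ℤ_ (∑-map (g x) ys f) (∑-cartesianProductWith g xs ys f))

∑-↭ : ∀ {A : Set} {xs ys : List A} (f : A → ℤ) → xs ↭ ys → ∑ xs f ≡ ∑ ys f
∑-↭ f _↭_.refl = refl
∑-↭ f (_↭_.prep x p) = cong (f x +ℤ_) (∑-↭ f p)
∑-↭ f (_↭_.swap x y p) = trans (exchange (f x) (f y) _) (cong (λ s → f y +ℤ (f x +ℤ s)) (∑-↭ f p))
  where
  exchange : ∀ a b c → a +ℤ (b +ℤ c) ≡ b +ℤ (a +ℤ c)
  exchange = solve-∀
∑-↭ f (_↭_.trans p q) = trans (∑-↭ f p) (∑-↭ f q)

length-filter-∑ : ∀ {A : Set} (p : A → Bool) xs → + length (filter (λ x → p x Bool.≟ true) xs) ≡ ∑ xs (⟦_⟧ ∘ p)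
length-filter-∑ p [] = refl
length-filter-∑ p (x ∷ xs) with p x
... | true = cong (1ℤ +ℤ_) (length-filter-∑ p xs)
... | false = trans (length-filter-∑ p xs) (sym (ℤ.+-identityˡ _))

∑-filter : ∀ {A : Set} (p q : A → Bool) xs →
           ∑ xs (λ x → ⟦ p x ∧ q x ⟧) ≡ ∑ (filter (λ x → p x Bool.≟ true) xs) (⟦_⟧ ∘ q)
∑-filter p q [] = refl
∑-filter p q (x ∷ xs) with p x
... | true = cong (⟦ q x ⟧ +ℤ_) (∑-filter p q xs)
... | false = trans (ℤ.+-identityˡ _) (∑-filter p q xs)

⟦∧⟧ : ∀ a b → ⟦ a ∧ b ⟧ ≡ ⟦ a ⟧ *ℤ ⟦ b ⟧
⟦∧⟧ true b = sym (ℤ.*-identityˡ ⟦ b ⟧)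
⟦∧⟧ false b = refl

GF : (Tree → ℤ) → Series
GF f n m = ∑ (trees n) (λ t → f t *ℤ ⟦ lis t ≡ᵇ m ⟧)

∑₂ : ℕ → (Tree → Tree → ℤ) → ℤ
∑₂ n h = ∑ (upTo (suc n)) λ i → ∑ (trees i) λ l → ∑ (trees (n ∸ i)) λ r → h l r

-- The exponent `lis l + lis r` is the one that a product of two series produces. It differs from
-- `lis (node l r)` exactly when `l` is a leaf, where it is smaller by one.
GF₂ : (Tree → Tree → ℤ) → Series
GF₂ h n m = ∑₂ n (λ l r → h l r *ℤ ⟦ lis l + lis r ≡ᵇ m ⟧)

∑₂-cong : ∀ n {h k} → (∀ l r → h l r ≡ k l r) → ∑₂ n h ≡ ∑₂ n k
∑₂-cong n e = ∑-cong (upTo (suc n)) λ i → ∑-cong (trees i) λ l → ∑-cong (trees (n ∸ i)) (e l)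

∑₂-zero : ∀ n {h} → (∀ l r → h l r ≡ 0ℤ) → ∑₂ n h ≡ 0ℤ
∑₂-zero n e = ∑-zero (upTo (suc n)) λ i → ∑-zero (trees i) λ l → ∑-zero (trees (n ∸ i)) (e l)

∑₂-+ : ∀ n h k → ∑₂ n (λ l r → h l r +ℤ k l r) ≡ ∑₂ n h +ℤ ∑₂ n k
∑₂-+ n h k = trans
  (∑-cong (upTo (suc n)) λ i → trans (∑-cong (trees i) λ l → ∑-+ (trees (n ∸ i)) (h l) (k l))
    (∑-+ (trees i) (λ l → ∑ (trees (n ∸ i)) (h l)) (λ l → ∑ (trees (n ∸ i)) (k l))))
  (∑-+ (upTo (suc n)) (λ i → ∑ (trees i) λ l → ∑ (trees (n ∸ i)) (h l)) (λ i → ∑ (trees i) λ l → ∑ (trees (n ∸ i)) (k l)))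

∑-trees-suc : ∀ n f → ∑ (trees (suc n)) f ≡ ∑₂ n (λ l r → f (node l r))
∑-trees-suc n f = trans (cong (λ ts → ∑ ts f) (trees-suc n)) (trans (∑-concatMap (λ i → cartesianProductWith node (trees i) (trees (n ∸ i))) (upTo (suc n)) f)
  (∑-cong (upTo (suc n)) λ i → ∑-cartesianProductWith node (trees i) (trees (n ∸ i)) f))

-- The coefficient form of q^a q^b = q^(a+b).
∑-kronecker : ∀ a b m → ∑ (upTo (suc m)) (λ j → ⟦ a ≡ᵇ j ⟧ *ℤ ⟦ b ≡ᵇ m ∸ j ⟧) ≡ ⟦ a + b ≡ᵇ m ⟧
∑-kronecker zero b m = begin
  ∑ (upTo (suc m)) (λ j → ⟦ 0 ≡ᵇ j ⟧ *ℤ ⟦ b ≡ᵇ m ∸ j ⟧)            ≡⟨ ∑-upTo-suc m (λ j → ⟦ 0 ≡ᵇ j ⟧ *ℤ ⟦ b ≡ᵇ m ∸ j ⟧) ⟩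
  1ℤ *ℤ ⟦ b ≡ᵇ m ⟧ +ℤ ∑ (upTo m) (λ j → 0ℤ *ℤ ⟦ b ≡ᵇ m ∸ suc j ⟧)
    ≡⟨ cong₂ _+ℤ_ (ℤ.*-identityˡ ⟦ b ≡ᵇ m ⟧) (∑-zero (upTo m) (λ _ → refl)) ⟩
  ⟦ b ≡ᵇ m ⟧ +ℤ 0ℤ                                                  ≡⟨ ℤ.+-identityʳ _ ⟩
  ⟦ b ≡ᵇ m ⟧ ∎
∑-kronecker (suc a) b zero = refl
∑-kronecker (suc a) b (suc m) = trans (∑-upTo-suc (suc m) (λ j → ⟦ suc a ≡ᵇ j ⟧ *ℤ ⟦ b ≡ᵇ suc m ∸ j ⟧))
  (trans (ℤ.+-identityˡ _) (∑-kronecker a b m))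

-- Products with x and q as shifts

≈-trans : ∀ {f g h} → f ≈ˢ g → g ≈ˢ h → f ≈ˢ h
≈-trans p q n m = trans (p n m) (q n m)

⊕-cong : ∀ {f f′ g g′} → f ≈ˢ f′ → g ≈ˢ g′ → (f ⊕ g) ≈ˢ (f′ ⊕ g′)
⊕-cong p q n m = cong₂ _+ℤ_ (p n m) (q n m)

⊖-cong : ∀ {f f′ g g′} → f ≈ˢ f′ → g ≈ˢ g′ → (f ⊖ g) ≈ˢ (f′ ⊖ g′)
⊖-cong p q n m = cong₂ _-_ (p n m) (q n m)

⊗-cong : ∀ {f f′ g g′} → f ≈ˢ f′ → g ≈ˢ g′ → (f ⊗ g) ≈ˢ (f′ ⊗ g′)
⊗-cong p q n m = ∑-cong (upTo (suc n)) λ i → ∑-cong (upTo (suc m)) λ j → cong₂ _*ℤ_ (p i j) (q (n ∸ i) (m ∸ j))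

⊗-congˡ : ∀ {f f′} g → f ≈ˢ f′ → (f ⊗ g) ≈ˢ (f′ ⊗ g)
⊗-congˡ g p = ⊗-cong {g = g} p (λ _ _ → refl)

infixr 8 x·_ q·_

x·_ : Series → Series
(x· f) zero m = 0ℤ
(x· f) (suc n) m = f n m

q·_ : Series → Series
(q· f) n zero = 0ℤ
(q· f) n (suc m) = f n m

x·-cong : ∀ {f g} → f ≈ˢ g → (x· f) ≈ˢ (x· g)
x·-cong p zero m = refl
x·-cong p (suc n) m = p n m

q·-cong : ∀ {f g} → f ≈ˢ g → (q· f) ≈ˢ (q· g)
q·-cong p n zero = refl
q·-cong p n (suc m) = p n m

x·-⊗ : ∀ f g → ((x· f) ⊗ g) ≈ˢ (x· (f ⊗ g))
x·-⊗ f g zero m = cong (_+ℤ 0ℤ) (∑-zero (upTo (suc m)) (λ _ → refl))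
x·-⊗ f g (suc n) m = trans (∑-upTo-suc (suc n) (λ i → ∑ (upTo (suc m)) λ j → (x· f) i j *ℤ g (suc n ∸ i) (m ∸ j)))
  (trans (cong (_+ℤ (f ⊗ g) n m) (∑-zero (upTo (suc m)) (λ _ → refl))) (ℤ.+-identityˡ _))

q·-⊗ : ∀ f g → ((q· f) ⊗ g) ≈ˢ (q· (f ⊗ g))
q·-⊗ f g n zero = ∑-zero (upTo (suc n)) (λ _ → refl)
q·-⊗ f g n (suc m) = ∑-cong (upTo (suc n)) λ i →
  trans (∑-upTo-suc (suc m) (λ j → (q· f) i j *ℤ g (n ∸ i) (suc m ∸ j)))
    (ℤ.+-identityˡ (∑ (upTo (suc m)) (λ j → f i j *ℤ g (n ∸ i) (m ∸ j))))

1-⊗ : ∀ f → (1ˢ ⊗ f) ≈ˢ f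
1-⊗ f n m = begin
  (1ˢ ⊗ f) n m                                              ≡⟨ ∑-upTo-suc n row ⟩
  row 0 +ℤ ∑ (upTo n) (λ i → row (suc i))
    ≡⟨ cong₂ _+ℤ_ (∑-upTo-suc m (λ j → 1ˢ 0 j *ℤ f n (m ∸ j))) (∑-zero (upTo n) λ i → ∑-zero (upTo (suc m)) λ _ → refl) ⟩
  1ℤ *ℤ f n m +ℤ ∑ (upTo m) (λ j → 0ℤ *ℤ f n (m ∸ suc j)) +ℤ 0ℤ
    ≡⟨ cong (λ z → 1ℤ *ℤ f n m +ℤ z +ℤ 0ℤ) (∑-zero (upTo m) (λ _ → refl)) ⟩
  1ℤ *ℤ f n m +ℤ 0ℤ +ℤ 0ℤ                                   ≡⟨ simplify (f n m) ⟩
  f n m ∎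
  where
  row : ℕ → ℤ
  row i = ∑ (upTo (suc m)) (λ j → 1ˢ i j *ℤ f (n ∸ i) (m ∸ j))
  simplify : ∀ a → 1ℤ *ℤ a +ℤ 0ℤ +ℤ 0ℤ ≡ a
  simplify = solve-∀

xˢ≈ : xˢ ≈ˢ (x· 1ˢ)
xˢ≈ zero m = refl
xˢ≈ (suc zero) zero = refl
xˢ≈ (suc zero) (suc m) = refl
xˢ≈ (suc (suc n)) m = refl

qˢ≈ : qˢ ≈ˢ (q· 1ˢ)
qˢ≈ zero zero = refl
qˢ≈ zero (suc zero) = refl
qˢ≈ zero (suc (suc m)) = refl
qˢ≈ (suc n) zero = refl
qˢ≈ (suc n) (suc m) = refl

xˢ⊗ : ∀ f → (xˢ ⊗ f) ≈ˢ (x· f)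
xˢ⊗ f = ≈-trans (⊗-congˡ f xˢ≈) (≈-trans (x·-⊗ 1ˢ f) (x·-cong (1-⊗ f)))

xˢ⊗⊗ : ∀ f g → (xˢ ⊗ f ⊗ g) ≈ˢ (x· (f ⊗ g))
xˢ⊗⊗ f g = ≈-trans (⊗-congˡ g (xˢ⊗ f)) (x·-⊗ f g)

xˢ⊗qˢ : (xˢ ⊗ qˢ) ≈ˢ (x· q· 1ˢ)
xˢ⊗qˢ = ≈-trans (xˢ⊗ qˢ) (x·-cong qˢ≈)

xˢ⊗qˢ⊗ : ∀ f → (xˢ ⊗ qˢ ⊗ f) ≈ˢ (x· q· f)
xˢ⊗qˢ⊗ f = ≈-trans (xˢ⊗⊗ qˢ f) (x·-cong
  (≈-trans (⊗-congˡ f qˢ≈) (≈-trans (q·-⊗ 1ˢ f) (q·-cong (1-⊗ f)))))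

-- The filter for 312 is separated from the other two conditions, because it alone yields the list
-- that is matched with the trees; those conditions become the weight of a tree.
F-GF : ∀ w → F w ≈ˢ GF (av w)
F-GF w n m = begin
  + Fcoef (red w) n m
    ≡⟨ length-filter-∑ (λ σ → avoidsB σ pat312 ∧ counted σ) (perms n) ⟩
  ∑ (perms n) (λ σ → ⟦ avoidsB σ pat312 ∧ counted σ ⟧)
    ≡⟨ ∑-filter (λ σ → avoidsB σ pat312) counted (perms n) ⟩
  ∑ (filter (λ σ → avoidsB σ pat312 Bool.≟ true) (perms n)) (⟦_⟧ ∘ counted)
    ≡⟨ ∑-↭ (⟦_⟧ ∘ counted) (avoiders-↭ n) ⟩
  ∑ (map (perm 0) (trees n)) (⟦_⟧ ∘ counted)
    ≡⟨ ∑-map (perm 0) (trees n) (⟦_⟧ ∘ counted) ⟩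
  ∑ (trees n) (λ t → ⟦ counted (perm 0 t) ⟧)
    ≡⟨ ∑-cong (trees n) weight ⟩
  GF (av w) n m ∎
  where
  counted : List ℕ → Bool
  counted σ = avoidsB σ (red w) ∧ (LIS σ ≡ᵇ m)
  weight : ∀ t → ⟦ counted (perm 0 t) ⟧ ≡ av w t *ℤ ⟦ lis t ≡ᵇ m ⟧
  weight t = trans (cong ⟦_⟧ (cong₂ _∧_ (avoidsB-red (perm 0 t) w) (cong (_≡ᵇ m) (LIS-perm 0 t)))) (⟦∧⟧ (avoidsB (perm 0 t) w) (lis t ≡ᵇ m))

-- The indicator of the empty permutation. Its generating function is 1, so each `- 1` of the
-- equations becomes `- isLeaf`, which removes the empty permutation from a series with constant
-- term 1.
isLeaf : Tree → ℤ
isLeaf leaf = 1ℤ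
isLeaf (node _ _) = 0ℤ

1-GF : 1ˢ ≈ˢ GF isLeaf
1-GF zero zero = refl
1-GF zero (suc m) = refl
1-GF (suc n) m = sym (trans (∑-trees-suc n _) (∑₂-zero n λ _ _ → refl))

⊖-GF : ∀ f g → (GF f ⊖ GF g) ≈ˢ GF (λ t → f t - g t)
⊖-GF f g n m = sym (trans (∑-cong (trees n) λ t → distrib (f t) (g t) ⟦ lis t ≡ᵇ m ⟧) (∑-- (trees n) _ _))
  where
  distrib : ∀ a b c → (a - b) *ℤ c ≡ a *ℤ c - b *ℤ c
  distrib = solve-∀

⊗-GF : ∀ f g → (GF f ⊗ GF g) ≈ˢ GF₂ (λ l r → f l *ℤ g r)
⊗-GF f g n m = ∑-cong (upTo (suc n)) λ i → begin
  ∑ js (λ j → GF f i j *ℤ GF g (n ∸ i) (m ∸ j))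
    ≡⟨ ∑-cong js (λ j → trans (∑-*ʳ (trees i) _ _)
         (∑-cong (trees i) λ l → ∑-*ˡ (trees (n ∸ i)) (f l *ℤ ⟦ lis l ≡ᵇ j ⟧) _)) ⟩
  ∑ js (λ j → ∑ (trees i) λ l → ∑ (trees (n ∸ i)) λ r → (f l *ℤ ⟦ lis l ≡ᵇ j ⟧) *ℤ (g r *ℤ ⟦ lis r ≡ᵇ m ∸ j ⟧))
    ≡⟨ ∑-swap js (trees i) _ ⟩
  ∑ (trees i) (λ l → ∑ js λ j → ∑ (trees (n ∸ i)) λ r → (f l *ℤ ⟦ lis l ≡ᵇ j ⟧) *ℤ (g r *ℤ ⟦ lis r ≡ᵇ m ∸ j ⟧))
    ≡⟨ ∑-cong (trees i) (λ l → trans (∑-swap js (trees (n ∸ i)) _) (∑-cong (trees (n ∸ i)) (collect l))) ⟩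
  ∑ (trees i) (λ l → ∑ (trees (n ∸ i)) λ r → f l *ℤ g r *ℤ ⟦ lis l + lis r ≡ᵇ m ⟧) ∎
  where
  js = upTo (suc m)
  interchange : ∀ a b c d → (a *ℤ b) *ℤ (c *ℤ d) ≡ (a *ℤ c) *ℤ (b *ℤ d)
  interchange = solve-∀
  collect : ∀ l r → ∑ js (λ j → (f l *ℤ ⟦ lis l ≡ᵇ j ⟧) *ℤ (g r *ℤ ⟦ lis r ≡ᵇ m ∸ j ⟧)) ≡
                    f l *ℤ g r *ℤ ⟦ lis l + lis r ≡ᵇ m ⟧
  collect l r = trans (∑-cong js λ j → interchange (f l) ⟦ lis l ≡ᵇ j ⟧ (g r) ⟦ lis r ≡ᵇ m ∸ j ⟧)
    (trans (sym (∑-*ˡ js (f l *ℤ g r) _)) (cong (f l *ℤ g r *ℤ_) (∑-kronecker (lis l) (lis r) m)))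

GF₂-cong : ∀ {h k} → (∀ l r → h l r ≡ k l r) → GF₂ h ≈ˢ GF₂ k
GF₂-cong e n m = ∑₂-cong n λ l r → cong (_*ℤ ⟦ lis l + lis r ≡ᵇ m ⟧) (e l r)

⊕-GF₂ : ∀ h k → (GF₂ h ⊕ GF₂ k) ≈ˢ GF₂ (λ l r → h l r +ℤ k l r)
⊕-GF₂ h k n m = sym (trans (∑₂-cong n λ l r → ℤ.*-distribʳ-+ ⟦ lis l + lis r ≡ᵇ m ⟧ (h l r) (k l r)) (∑₂-+ n _ _))

0-GF₂ : 0ˢ ≈ˢ GF₂ (λ _ _ → 0ℤ)
0-GF₂ n m = sym (∑₂-zero n λ _ _ → refl)

sum-GF₂ : ∀ {A : Set} (js : List A) (h : A → Tree → Tree → ℤ) →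
          sumˢ (map (λ j → GF₂ (h j)) js) ≈ˢ GF₂ (λ l r → ∑ js (λ j → h j l r))
sum-GF₂ [] h = 0-GF₂
sum-GF₂ (j ∷ js) h = ≈-trans (⊕-cong {f = GF₂ (h j)} (λ _ _ → refl) (sum-GF₂ js h)) (⊕-GF₂ (h j) (λ l r → ∑ js (λ j → h j l r)))

sumˢ-cong : ∀ {A : Set} (js : List A) {f g : A → Series} → (∀ j → f j ≈ˢ g j) → sumˢ (map f js) ≈ˢ sumˢ (map g js)
sumˢ-cong [] e n m = refl
sumˢ-cong (j ∷ js) e = ⊕-cong (e j) (sumˢ-cong js e)

-- Splitting off the root: the factor (perm l) 1 has longest increasing length lis l, except that
-- it is 1 = lis l + 1 when l is a leaf.
GF-root : ∀ f → f leaf ≡ 1ℤ →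
  GF f ≈ˢ (1ˢ ⊕ x· q· GF₂ (λ l r → isLeaf l *ℤ f (node l r)) ⊕ x· GF₂ (λ l r → (1ℤ - isLeaf l) *ℤ f (node l r)))
GF-root f e zero zero rewrite e = refl
GF-root f e zero (suc m) rewrite e = refl
GF-root f e (suc n) m = trans (∑-trees-suc n _) (trans (∑₂-cong n (weight m)) (trans (∑₂-+ n (shifted m) _)
  (cong (_+ℤ GF₂ (λ l r → (1ℤ - isLeaf l) *ℤ f (node l r)) n m) (trans (shift m) (sym (ℤ.+-identityˡ _))))))
  where
  -- Over an empty left subtree the root entry accounts for one factor q, so the exponent left for
  -- the subtrees is one less and exponent 0 receives nothing.
  shifted : ℕ → Tree → Tree → ℤ
  shifted zero l r = 0ℤ
  shifted (suc m) l r = isLeaf l *ℤ f (node l r) *ℤ ⟦ lis l + lis r ≡ᵇ m ⟧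
  shift : ∀ m → ∑₂ n (shifted m) ≡ (q· GF₂ (λ l r → isLeaf l *ℤ f (node l r))) n m
  shift zero = ∑₂-zero n (λ _ _ → refl)
  shift (suc m) = refl
  lis-nonzero : ∀ l r → 1 ⊔ lis (node l r) ≡ lis (node l r)
  lis-nonzero l r with lis l
  ... | zero = refl
  ... | suc _ = refl
  node-weight : ∀ a b → a *ℤ b ≡ 0ℤ +ℤ (1ℤ - 0ℤ) *ℤ a *ℤ b
  node-weight = solve-∀
  node-weight′ : ∀ a b c → a *ℤ b ≡ 0ℤ *ℤ a *ℤ c +ℤ (1ℤ - 0ℤ) *ℤ a *ℤ b
  node-weight′ = solve-∀
  leaf-weight : ∀ a b c → a *ℤ b ≡ 1ℤ *ℤ a *ℤ b +ℤ (1ℤ - 1ℤ) *ℤ a *ℤ c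
  leaf-weight = solve-∀
  leaf-weight₀ : ∀ a c → a *ℤ 0ℤ ≡ 0ℤ +ℤ (1ℤ - 1ℤ) *ℤ a *ℤ c
  leaf-weight₀ = solve-∀
  weight : ∀ m l r → f (node l r) *ℤ ⟦ lis (node l r) ≡ᵇ m ⟧ ≡
                     shifted m l r +ℤ (1ℤ - isLeaf l) *ℤ f (node l r) *ℤ ⟦ lis l + lis r ≡ᵇ m ⟧
  weight zero leaf r = leaf-weight₀ (f (node leaf r)) ⟦ lis r ≡ᵇ 0 ⟧
  weight (suc m) leaf r = leaf-weight (f (node leaf r)) ⟦ lis r ≡ᵇ m ⟧ ⟦ lis r ≡ᵇ suc m ⟧
  weight zero (node a b) r rewrite lis-nonzero a b = node-weight (f (node (node a b) r)) ⟦ lis (node a b) + lis r ≡ᵇ 0 ⟧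
  weight (suc m) (node a b) r rewrite lis-nonzero a b =
    node-weight′ (f (node (node a b) r)) ⟦ lis (node a b) + lis r ≡ᵇ suc m ⟧ ⟦ lis (node a b) + lis r ≡ᵇ m ⟧

-- The functional equations

∑-upTo-last : ∀ n (f : ℕ → ℤ) → ∑ (upTo (suc n)) f ≡ ∑ (upTo n) f +ℤ f n
∑-upTo-last n f = trans (cong (λ xs → ∑ xs f) (sym (upTo-∷ʳ n)))
  (trans (∑-++ (upTo n) (n ∷ []) f) (cong (∑ (upTo n) f +ℤ_) (ℤ.+-identityʳ (f n))))

⊗-1 : ∀ f → (f ⊗ 1ˢ) ≈ˢ f
⊗-1 f n m = begin
  (f ⊗ 1ˢ) n m                                   ≡⟨ ∑-upTo-last n row ⟩
  ∑ (upTo n) row +ℤ row n                        ≡⟨ cong₂ _+ℤ_ (∑-zero-∈ (upTo n) lower-row) (∑-upTo-last m _) ⟩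
  0ℤ +ℤ (∑ (upTo m) (entry n) +ℤ entry n m)      ≡⟨ cong (λ z → 0ℤ +ℤ (z +ℤ entry n m)) (∑-zero-∈ (upTo m) lower-entry) ⟩
  0ℤ +ℤ (0ℤ +ℤ entry n m)
    ≡⟨ cong₂ (λ a b → 0ℤ +ℤ (0ℤ +ℤ f n m *ℤ 1ˢ a b)) (n∸n≡0 n) (n∸n≡0 m) ⟩
  0ℤ +ℤ (0ℤ +ℤ f n m *ℤ 1ℤ)                      ≡⟨ simplify (f n m) ⟩
  f n m ∎
  where
  entry : ℕ → ℕ → ℤ
  entry i j = f i j *ℤ 1ˢ (n ∸ i) (m ∸ j)
  row : ℕ → ℤ
  row i = ∑ (upTo (suc m)) (entry i)
  simplify : ∀ a → 0ℤ +ℤ (0ℤ +ℤ a *ℤ 1ℤ) ≡ a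
  simplify = solve-∀
  ∑-zero-∈ : ∀ xs {g : ℕ → ℤ} → (∀ {x} → x ∈ xs → g x ≡ 0ℤ) → ∑ xs g ≡ 0ℤ
  ∑-zero-∈ xs {g} h = trans (∑-cong-∈ xs h) (∑-zero xs (λ _ → refl))
  1ˢ-pos : ∀ {a} b → 0 < a → 1ˢ a b ≡ 0ℤ
  1ˢ-pos b (s≤s _) = refl
  1ˢ-posʳ : ∀ a {b} → 0 < b → 1ˢ a b ≡ 0ℤ
  1ˢ-posʳ zero (s≤s _) = refl
  1ˢ-posʳ (suc a) (s≤s _) = refl
  lower-row : ∀ {i} → i ∈ upTo n → row i ≡ 0ℤ
  lower-row {i} i∈ = ∑-zero (upTo (suc m)) λ j →
    trans (cong (f i j *ℤ_) (1ˢ-pos (m ∸ j) (m<n⇒0<n∸m (∈-upTo⁻ i∈)))) (ℤ.*-zeroʳ (f i j))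
  lower-entry : ∀ {j} → j ∈ upTo m → entry n j ≡ 0ℤ
  lower-entry {j} j∈ = trans (cong (f n j *ℤ_) (1ˢ-posʳ (n ∸ n) (m<n⇒0<n∸m (∈-upTo⁻ j∈)))) (ℤ.*-zeroʳ (f n j))

-- A single series is written over pairs whose other tree is empty, so that it can be compared with
-- products pair by pair; `GF-right` does the same on the other side.
GF-left : ∀ f → GF f ≈ˢ GF₂ (λ l r → f l *ℤ isLeaf r)
GF-left f = ≈-trans (λ n m → sym (⊗-1 (GF f) n m)) (≈-trans (⊗-cong {f = GF f} (λ _ _ → refl) 1-GF) (⊗-GF f isLeaf))

GF-right : ∀ f → GF f ≈ˢ GF₂ (λ l r → isLeaf l *ℤ f r)
GF-right f = ≈-trans (λ n m → sym (1-⊗ (GF f) n m)) (≈-trans (⊗-congˡ (GF f) 1-GF) (⊗-GF isLeaf f))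

1-GF₂ : 1ˢ ≈ˢ GF₂ (λ l r → isLeaf l *ℤ isLeaf r)
1-GF₂ = ≈-trans 1-GF (GF-right isLeaf)

F⊖1-GF : ∀ w → (F w ⊖ 1ˢ) ≈ˢ GF (λ t → av w t - isLeaf t)
F⊖1-GF w = ≈-trans (⊖-cong (F-GF w) 1-GF) (⊖-GF (av w) isLeaf)

F⊖F-GF : ∀ v w → (F v ⊖ F w) ≈ˢ GF (λ t → av v t - av w t)
F⊖F-GF v w = ≈-trans (⊖-cong (F-GF v) (F-GF w)) (⊖-GF (av v) (av w))

F-red : ∀ w → F (red w) ≈ˢ F w
F-red w n m = cong (λ v → + Fcoef v n m) (red-idem w)

F-red⊖1-GF : ∀ w → (F (red w) ⊖ 1ˢ) ≈ˢ GF (λ t → av w t - isLeaf t)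
F-red⊖1-GF w = ≈-trans (⊖-cong {g = 1ˢ} (F-red w) (λ _ _ → refl)) (F⊖1-GF w)

x·GF₂-cong : ∀ {h k} → (∀ l r → h l r ≡ k l r) → (x· GF₂ h) ≈ˢ (x· GF₂ k)
x·GF₂-cong e = x·-cong (GF₂-cong e)

x·GF₂-⊕ : ∀ {f g} h k → f ≈ˢ (x· GF₂ h) → g ≈ˢ (x· GF₂ k) → (f ⊕ g) ≈ˢ (x· GF₂ (λ l r → h l r +ℤ k l r))
x·GF₂-⊕ h k p q zero m = cong₂ _+ℤ_ (p 0 m) (q 0 m)
x·GF₂-⊕ h k p q (suc n) m = trans (cong₂ _+ℤ_ (p (suc n) m) (q (suc n) m)) (⊕-GF₂ h k n m)

x·q·GF₂-⊕ : ∀ {f g} h k → f ≈ˢ (x· q· GF₂ h) → g ≈ˢ (x· q· GF₂ k) → (f ⊕ g) ≈ˢ (x· q· GF₂ (λ l r → h l r +ℤ k l r))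
x·q·GF₂-⊕ h k p q zero m = cong₂ _+ℤ_ (p 0 m) (q 0 m)
x·q·GF₂-⊕ h k p q (suc n) zero = cong₂ _+ℤ_ (p (suc n) 0) (q (suc n) 0)
x·q·GF₂-⊕ h k p q (suc n) (suc m) = trans (cong₂ _+ℤ_ (p (suc n) (suc m)) (q (suc n) (suc m))) (⊕-GF₂ h k n m)

x⊗-GF₂ : ∀ f h → f ≈ˢ GF₂ h → (xˢ ⊗ f) ≈ˢ (x· GF₂ h)
x⊗-GF₂ f h p = ≈-trans (xˢ⊗ f) (x·-cong p)

x⊗[F⊖1]-GF₂ : ∀ w → (xˢ ⊗ (F w ⊖ 1ˢ)) ≈ˢ (x· GF₂ (λ l r → (av w l - isLeaf l) *ℤ isLeaf r))
x⊗[F⊖1]-GF₂ w = x⊗-GF₂ (F w ⊖ 1ˢ) (λ l r → (av w l - isLeaf l) *ℤ isLeaf r)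
  (≈-trans (F⊖1-GF w) (GF-left (λ t → av w t - isLeaf t)))

x⊗q⊗-GF₂ : ∀ f a → f ≈ˢ GF a → (xˢ ⊗ qˢ ⊗ f) ≈ˢ (x· q· GF₂ (λ l r → isLeaf l *ℤ a r))
x⊗q⊗-GF₂ f a p = ≈-trans (xˢ⊗qˢ⊗ f) (x·-cong (q·-cong (≈-trans p (GF-right a))))

x⊗q-GF₂ : (xˢ ⊗ qˢ) ≈ˢ (x· q· GF₂ (λ l r → isLeaf l *ℤ isLeaf r))
x⊗q-GF₂ = ≈-trans xˢ⊗qˢ (x·-cong (q·-cong 1-GF₂))

x⊗⊗-GF₂ : ∀ f g a b → f ≈ˢ GF a → g ≈ˢ GF b → (xˢ ⊗ f ⊗ g) ≈ˢ (x· GF₂ (λ l r → a l *ℤ b r))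
x⊗⊗-GF₂ f g a b p q = ≈-trans (xˢ⊗⊗ f g) (x·-cong (≈-trans (⊗-cong p q) (⊗-GF a b)))

δ-GF₂ : ∀ b f h → f ≈ˢ (x· GF₂ h) → δ b f ≈ˢ (x· GF₂ (λ l r → if b then h l r else 0ℤ))
δ-GF₂ true f h p = p
δ-GF₂ false f h p zero m = refl
δ-GF₂ false f h p (suc n) m = 0-GF₂ n m

av-leaf : ∀ {w} → w ≢ [] → av w leaf ≡ 1ℤ
av-leaf {w} w≢[] = cong (⟦_⟧ ∘ not) (≢true⇒≡false {containsᵗ w leaf} (w≢[] ∘ containsᵗ⇒ leaf))

av-contains : ∀ {w} t → TreeContains t w → av w t ≡ 0ℤ
av-contains t c = cong (⟦_⟧ ∘ not) (⇒containsᵗ t c)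

∑-telescope : ∀ R (g : ℕ → ℤ) → ∑ (upTo R) (λ j → g (suc j) - g j) ≡ g R - g 0
∑-telescope zero g = sym (ℤ.+-inverseʳ (g 0))
∑-telescope (suc R) g = trans (∑-upTo-last R (λ j → g (suc j) - g j))
  (trans (cong (_+ℤ (g (suc R) - g R)) (∑-telescope R g)) (collapse (g 0) (g R) (g (suc R))))
  where
  collapse : ∀ a b c → (b - a) +ℤ (c - b) ≡ c - a
  collapse = solve-∀

concat-drop≢[] : ∀ {bs j} → All Block bs → j < length bs → concat (drop j bs) ≢ []
concat-drop≢[] {b ∷ bs} {zero} (B ∷ _) _ e = block≢[] B (++-conicalˡ b _ e)
concat-drop≢[] {b ∷ bs} {suc j} (_ ∷ Bs) (s≤s j<) = concat-drop≢[] Bs j<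

∑-fromTo : ∀ a b (f : ℕ → ℤ) → ∑ (fromTo a b) f ≡ ∑ (upTo (suc b ∸ a)) (λ j → f (a + j))
∑-fromTo a b f = ∑-map (λ j → a + j) (upTo (suc b ∸ a)) f

private
  cancelʳ : ∀ a → a *ℤ (1ℤ - 1ℤ) ≡ 0ℤ
  cancelʳ = solve-∀
  cancelˡ : ∀ a → (1ℤ - 1ℤ) *ℤ a ≡ 0ℤ
  cancelˡ = solve-∀
  minus0 : ∀ a → a - 0ℤ ≡ a
  minus0 = solve-∀

-- The equations in terms of blocks

blockSeries : List (List ℕ) → ℕ → Series
blockSeries bs a = sumˢ (map (λ j → (F (concat (take (suc j) bs)) ⊖ F (concat (take j bs))) ⊗
                                    (F (red (concat (drop j bs))) ⊖ 1ˢ)) (fromTo a (length bs ∸ 1)))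

EmptyHeadEquation : List ℕ → List (List ℕ) → Set
EmptyHeadEquation τ bs =
  F τ ≈ˢ (1ˢ ⊕ xˢ ⊗ qˢ ⊕ xˢ ⊗ (F τ ⊖ 1ˢ) ⊕ xˢ ⊗ qˢ ⊗ (F (red (concat (drop 1 bs))) ⊖ 1ˢ) ⊕ xˢ ⊗ blockSeries bs 1)

NonemptyHeadEquation : List ℕ → List (List ℕ) → List ℕ → Set
NonemptyHeadEquation τ bs u =
  F τ ≈ˢ (1ˢ ⊕ xˢ ⊗ qˢ
    ⊕ δ (isZero (length bs ∸ 1)) (xˢ ⊗ (F u ⊖ 1ˢ))
    ⊕ δ (isNonZero (length bs ∸ 1)) (xˢ ⊗ (F τ ⊖ 1ˢ))
    ⊕ xˢ ⊗ qˢ ⊗ (F τ ⊖ 1ˢ)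
    ⊕ xˢ ⊗ blockSeries bs 2
    ⊕ δ (isNonZero (length bs ∸ 1)) (xˢ ⊗ (F (concat (take 2 bs)) ⊖ F u) ⊗ (F (red (concat (drop 1 bs))) ⊖ 1ˢ))
    ⊕ xˢ ⊗ (F u ⊖ 1ˢ) ⊗ (F τ ⊖ 1ˢ))

module Coefficients {u m cs} (m<u : All (m <_) u) (nf : NormalForm ((u ++ m ∷ []) ∷ cs)) where
  bs : List (List ℕ)
  bs = (u ++ m ∷ []) ∷ cs

  τ : List ℕ
  τ = concat bs

  pre suf : ℕ → Tree → ℤ
  pre j = av (concat (take j bs))
  suf j = av (concat (drop j bs))

  chain : Tree → ℕ → ℤ
  chain l j = ⟦ not (prefix⊑ u bs l j) ⟧

  τ≢[] : τ ≢ []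
  τ≢[] = concat-drop≢[] {j = 0} (proj₁ nf) (s≤s z≤n)

  pre-leaf : ∀ j → pre (suc j) leaf ≡ 1ℤ
  pre-leaf j = av-leaf (concat-take≢[] {j} bs (s≤s z≤n) (proj₁ nf))

  suf-leaf : ∀ {j} → j ≤ length cs → suf j leaf ≡ 1ℤ
  suf-leaf j≤ = av-leaf (concat-drop≢[] (proj₁ nf) (s≤s j≤))

  τ-leaf : av τ leaf ≡ 1ℤ
  τ-leaf = av-leaf τ≢[]

  -- The summand at j = 0 stands apart because `chain l 0` vanishes and `chain l 1` concerns `u`;
  -- from index 2 on, `chain` and `pre` agree.
  τ-node : ∀ l r → av τ (node l r) ≡ (av u l - 0ℤ) *ℤ av τ r +ℤ
    ∑ (upTo (length cs)) (λ j → (pre (2 + j) l - chain l (suc j)) *ℤ suf (suc j) r)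
  τ-node l r = trans (av-node m<u nf l r) (∑-upTo-suc (length cs) (λ j → (chain l (suc j) - chain l j) *ℤ suf j r))

  -- A leaf avoids every nonempty suffix, so all second factors are 1 and only the last value of
  -- `chain` survives.
  τ-node-leaf : ∀ l → av τ (node l leaf) ≡ chain l (length bs)
  τ-node-leaf l = begin
    av τ (node l leaf)
      ≡⟨ av-node m<u nf l leaf ⟩
    ∑ (upTo (length bs)) (λ j → (chain l (suc j) - chain l j) *ℤ suf j leaf)
      ≡⟨ ∑-cong-∈ (upTo (length bs)) (λ {j} j∈ →
           trans (cong ((chain l (suc j) - chain l j) *ℤ_) (av-leaf (concat-drop≢[] (proj₁ nf) (∈-upTo⁻ j∈))))
                 (ℤ.*-identityʳ (chain l (suc j) - chain l j))) ⟩
    ∑ (upTo (length bs)) (λ j → chain l (suc j) - chain l j)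
      ≡⟨ ∑-telescope (length bs) (chain l) ⟩
    chain l (length bs) - 0ℤ
      ≡⟨ minus0 (chain l (length bs)) ⟩
    chain l (length bs) ∎

  pre-all : ∀ l → pre (length bs) l ≡ av τ l
  pre-all l = cong (λ xs → av (concat xs) l) (take-all (length bs) bs ≤-refl)

  block-sum : ℕ → Tree → Tree → ℤ
  block-sum a l r = ∑ (fromTo a (length cs)) (λ j → (pre (suc j) l - pre j l) *ℤ (suf j r - isLeaf r))

  -- From index 1 on both prefixes in a difference are nonempty, hence avoided by the leaf, and the
  -- difference is 1 - 1.
  block-sum-leafˡ : ∀ a r → block-sum (suc a) leaf r ≡ 0ℤ
  block-sum-leafˡ a r = trans (∑-fromTo (suc a) (length cs) _) (∑-zero (upTo (length cs ∸ a)) λ j →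
    trans (cong₂ (λ x y → (x - y) *ℤ (suf (suc a + j) r - isLeaf r)) (pre-leaf (suc a + j)) (pre-leaf (a + j)))
          (cancelˡ (suf (suc a + j) r - isLeaf r)))

  block-sum-leafʳ : ∀ a l → a ≤ 1 → block-sum (suc a) l leaf ≡ 0ℤ
  block-sum-leafʳ a l a≤1 = trans (∑-fromTo (suc a) (length cs) _) (trans
    (∑-cong-∈ (upTo (length cs ∸ a)) {g = λ _ → 0ℤ} λ {j} j∈ →
      trans (cong (λ x → (pre (2 + a + j) l - pre (suc a + j) l) *ℤ (x - 1ℤ)) (suf-leaf (bound a≤1 (∈-upTo⁻ j∈))))
            (cancelʳ (pre (2 + a + j) l - pre (suc a + j) l)))
    (∑-zero (upTo (length cs ∸ a)) (λ _ → refl)))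
    where
    bound : ∀ {j a n} → a ≤ 1 → j < n ∸ a → suc a + j ≤ n
    bound {a = zero} _ p = p
    bound {a = suc zero} {suc n} _ p = s≤s p
    bound {a = suc (suc _)} (s≤s ())

  block-sum-nodeʳ : ∀ a l r₁ r₂ → block-sum a l (node r₁ r₂) ≡
    ∑ (upTo (suc (length cs) ∸ a)) (λ j → (pre (suc (a + j)) l - pre (a + j) l) *ℤ suf (a + j) (node r₁ r₂))
  block-sum-nodeʳ a l r₁ r₂ = trans (∑-fromTo a (length cs) _) (∑-cong (upTo (suc (length cs) ∸ a)) λ j →
    cong ((pre (suc (a + j)) l - pre (a + j) l) *ℤ_) (minus0 (suf (a + j) (node r₁ r₂))))

  -- Reduces an equation to two integer identities per pair of subtrees: `Q` collects the terms with
  -- factor xq, from empty left subtrees, and `X` those with factor x, from nonempty ones.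
  F-root : ∀ {Q X} h k → Q ≈ˢ (x· q· GF₂ h) → X ≈ˢ (x· GF₂ k) →
    (∀ l r → isLeaf l *ℤ av τ (node l r) ≡ h l r) → (∀ l r → (1ℤ - isLeaf l) *ℤ av τ (node l r) ≡ k l r) →
    F τ ≈ˢ (1ˢ ⊕ Q ⊕ X)
  F-root h k Q≈ X≈ h-weight k-weight n m = trans (F-GF τ n m) (trans (GF-root (av τ) τ-leaf n m)
    (cong₂ (λ a b → 1ˢ n m +ℤ a +ℤ b)
      (trans (x·-cong (q·-cong (GF₂-cong h-weight)) n m) (sym (Q≈ n m)))
      (trans (x·GF₂-cong k-weight n m) (sym (X≈ n m)))))

  block-sum-GF₂ : ∀ a → blockSeries bs a ≈ˢ GF₂ (block-sum a)
  block-sum-GF₂ a = ≈-trans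
    (sumˢ-cong (fromTo a (length cs)) λ j →
      ≈-trans (⊗-cong (F⊖F-GF (concat (take (suc j) bs)) (concat (take j bs))) (F-red⊖1-GF (concat (drop j bs))))
              (⊗-GF (λ l → pre (suc j) l - pre j l) (λ r → suf j r - isLeaf r)))
    (sum-GF₂ (fromTo a (length cs)) (λ j l r → (pre (suc j) l - pre j l) *ℤ (suf j r - isLeaf r)))

-- The equation for empty τ^(0)

module EmptyHead {m c cs} (nf : NormalForm ((m ∷ []) ∷ c ∷ cs)) where
  open Coefficients {[]} {m} {c ∷ cs} [] nf

  av-[] : ∀ t → av [] t ≡ 0ℤ
  av-[] t = av-contains t (tree-[] t)

  chain-leaf : ∀ j → chain leaf (2 + j) ≡ 1ℤ
  chain-leaf j = pre-leaf (suc j)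

  -- At index 1 both sides are 0, since a nonempty tree contains a single entry. On a leaf they
  -- would differ, which is why the empty left subtree is treated separately.
  chain-node : ∀ a b j → chain (node a b) (suc j) ≡ pre (suc j) (node a b)
  chain-node a b zero = trans (av-[] (node a b)) (sym (av-contains (node a b)
    (m ∷ [] , [] , refl , [] ∷ [] , inj₂ ([] , m , refl , [] , tree-[] a) , tree-[] b)))
  chain-node a b (suc j) = refl

  τ-node-∑ : ∀ l r → av τ (node l r) ≡
    ∑ (upTo (suc (length cs))) (λ j → (pre (2 + j) l - chain l (suc j)) *ℤ suf (suc j) r)
  τ-node-∑ l r = trans (τ-node l r)
    (trans (cong (λ x → (x - 0ℤ) *ℤ av τ r +ℤ rest) (av-[] l)) (ℤ.+-identityˡ rest))
    where rest = ∑ (upTo (suc (length cs))) (λ j → (pre (2 + j) l - chain l (suc j)) *ℤ suf (suc j) r)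

  -- On a leaf `chain` jumps from 0 to 1 only between indices 1 and 2: the empty τ^(0) occurs there,
  -- but no longer prefix does.
  τ-leaf-node : ∀ r → av τ (node leaf r) ≡ suf 1 r
  τ-leaf-node r = begin
    av τ (node leaf r)
      ≡⟨ τ-node-∑ leaf r ⟩
    ∑ (upTo (suc (length cs))) (λ j → (pre (2 + j) leaf - chain leaf (suc j)) *ℤ suf (suc j) r)
      ≡⟨ ∑-upTo-suc (length cs) (λ j → (pre (2 + j) leaf - chain leaf (suc j)) *ℤ suf (suc j) r) ⟩
    (pre 2 leaf - chain leaf 1) *ℤ suf 1 r +ℤ
      ∑ (upTo (length cs)) (λ j → (pre (3 + j) leaf - chain leaf (2 + j)) *ℤ suf (2 + j) r)
      ≡⟨ cong₂ _+ℤ_ (cong₂ (λ x y → (x - y) *ℤ suf 1 r) (pre-leaf 1) (av-[] leaf))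
           (∑-zero (upTo (length cs)) λ j →
             trans (cong₂ (λ x y → (x - y) *ℤ suf (2 + j) r) (pre-leaf (2 + j)) (chain-leaf j)) (cancelˡ (suf (2 + j) r))) ⟩
    (1ℤ - 0ℤ) *ℤ suf 1 r +ℤ 0ℤ
      ≡⟨ simplify (suf 1 r) ⟩
    suf 1 r ∎
    where
    simplify : ∀ a → (1ℤ - 0ℤ) *ℤ a +ℤ 0ℤ ≡ a
    simplify = solve-∀

  q-weight : ∀ l r → isLeaf l *ℤ av τ (node l r) ≡ isLeaf l *ℤ isLeaf r +ℤ isLeaf l *ℤ (suf 1 r - isLeaf r)
  q-weight leaf r = trans (cong (1ℤ *ℤ_) (τ-leaf-node r)) (regroup (suf 1 r) (isLeaf r))
    where
    regroup : ∀ a b → 1ℤ *ℤ a ≡ 1ℤ *ℤ b +ℤ 1ℤ *ℤ (a - b)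
    regroup = solve-∀
  q-weight (node a b) r = refl

  -- For empty `l` both sides vanish; for empty `r` the telescoped value is `av τ l`; if both are
  -- nonempty, the two sums agree term by term.
  weight : ∀ l r → (1ℤ - isLeaf l) *ℤ av τ (node l r) ≡ (av τ l - isLeaf l) *ℤ isLeaf r +ℤ block-sum 1 l r
  weight leaf r = sym (trans
    (cong₂ (λ x y → (x - 1ℤ) *ℤ isLeaf r +ℤ y) τ-leaf (block-sum-leafˡ 0 r)) (regroup (av τ (node leaf r)) (isLeaf r)))
    where
    regroup : ∀ a b → (1ℤ - 1ℤ) *ℤ b +ℤ 0ℤ ≡ (1ℤ - 1ℤ) *ℤ a
    regroup = solve-∀
  weight l@(node _ _) leaf = trans (cong ((1ℤ - 0ℤ) *ℤ_) (trans (τ-node-leaf l) (pre-all l)))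
    (trans (regroup (av τ l)) (cong ((av τ l - 0ℤ) *ℤ 1ℤ +ℤ_) (sym (block-sum-leafʳ 0 l z≤n))))
    where
    regroup : ∀ a → (1ℤ - 0ℤ) *ℤ a ≡ (a - 0ℤ) *ℤ 1ℤ +ℤ 0ℤ
    regroup = solve-∀
  weight l@(node a b) r@(node r₁ r₂) = begin
    (1ℤ - 0ℤ) *ℤ av τ (node l r)              ≡⟨ ℤ.*-identityˡ _ ⟩
    av τ (node l r)                           ≡⟨ τ-node-∑ l r ⟩
    ∑ (upTo (suc (length cs))) (λ j → (pre (2 + j) l - chain l (suc j)) *ℤ suf (suc j) r)
      ≡⟨ ∑-cong (upTo (suc (length cs))) (λ j → cong (λ x → (pre (2 + j) l - x) *ℤ suf (suc j) r) (chain-node a b j)) ⟩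
    ∑ (upTo (suc (length cs))) (λ j → (pre (2 + j) l - pre (suc j) l) *ℤ suf (suc j) r)
      ≡⟨ sym (block-sum-nodeʳ 1 l r₁ r₂) ⟩
    block-sum 1 l r                           ≡⟨ regroup (av τ l) (block-sum 1 l r) ⟩
    (av τ l - 0ℤ) *ℤ 0ℤ +ℤ block-sum 1 l r ∎
    where
    regroup : ∀ a b → b ≡ (a - 0ℤ) *ℤ 0ℤ +ℤ b
    regroup = solve-∀

  equation : EmptyHeadEquation τ bs
  equation n k = trans
    (F-root _ _
      (x·q·GF₂-⊕ (λ l r → isLeaf l *ℤ isLeaf r) (λ l r → isLeaf l *ℤ (suf 1 r - isLeaf r)) x⊗q-GF₂
        (x⊗q⊗-GF₂ sufSeries (λ r → suf 1 r - isLeaf r) (F-red⊖1-GF (concat (drop 1 bs)))))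
      (x·GF₂-⊕ (λ l r → (av τ l - isLeaf l) *ℤ isLeaf r) (block-sum 1) (x⊗[F⊖1]-GF₂ τ)
        (x⊗-GF₂ (blockSeries bs 1) (block-sum 1) (block-sum-GF₂ 1)))
      q-weight weight n k)
    (regroup (1ˢ n k) ((xˢ ⊗ qˢ) n k) ((xˢ ⊗ qˢ ⊗ sufSeries) n k) ((xˢ ⊗ (F τ ⊖ 1ˢ)) n k) ((xˢ ⊗ blockSeries bs 1) n k))
    where
    sufSeries : Series
    sufSeries = F (red (concat (drop 1 bs))) ⊖ 1ˢ
    regroup : ∀ a b c d e → a +ℤ (b +ℤ c) +ℤ (d +ℤ e) ≡ a +ℤ b +ℤ d +ℤ c +ℤ e
    regroup = solve-∀

-- The equation for nonempty τ^(0)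

module NonemptyHead {u m} (u≢[] : u ≢ []) (m<u : All (m <_) u) where

  module _ {cs} (nf : NormalForm ((u ++ m ∷ []) ∷ cs)) where
    open Coefficients m<u nf

    q-weight : ∀ l r → isLeaf l *ℤ av τ (node l r) ≡ isLeaf l *ℤ isLeaf r +ℤ isLeaf l *ℤ (av τ r - isLeaf r)
    q-weight (node a b) r = refl
    q-weight leaf r = begin
      1ℤ *ℤ av τ (node leaf r)
        ≡⟨ cong (1ℤ *ℤ_) (τ-node leaf r) ⟩
      1ℤ *ℤ ((av u leaf - 0ℤ) *ℤ av τ r +ℤ ∑ (upTo (length cs)) (λ j → (pre (2 + j) leaf - chain leaf (suc j)) *ℤ suf (suc j) r))
        -- A leaf avoids τ^(0) and all longer prefixes, so its `chain` is constantly 1 from index 1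
        -- on and the remaining differences cancel.
        ≡⟨ cong₂ (λ x y → 1ℤ *ℤ ((x - 0ℤ) *ℤ av τ r +ℤ y)) (av-leaf u≢[]) (∑-zero (upTo (length cs)) λ j →
             trans (cong₂ (λ x y → (x - y) *ℤ suf (suc j) r) (pre-leaf (suc j)) (chain-leaf j)) (cancelˡ (suf (suc j) r))) ⟩
      1ℤ *ℤ ((1ℤ - 0ℤ) *ℤ av τ r +ℤ 0ℤ)
        ≡⟨ regroup (av τ r) (isLeaf r) ⟩
      1ℤ *ℤ isLeaf r +ℤ 1ℤ *ℤ (av τ r - isLeaf r) ∎
      where
      chain-leaf : ∀ j → chain leaf (suc j) ≡ 1ℤ
      chain-leaf zero = av-leaf u≢[]
      chain-leaf (suc j) = pre-leaf (suc j)
      regroup : ∀ a b → 1ℤ *ℤ ((1ℤ - 0ℤ) *ℤ a +ℤ 0ℤ) ≡ 1ℤ *ℤ b +ℤ 1ℤ *ℤ (a - b)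
      regroup = solve-∀

    -- Coefficients of the terms with factor x, in the order of the equation; the third place
    -- belongs to `block-sum 2`.
    k₁ k₂ k₄ k₅ : Tree → Tree → ℤ
    k₁ l r = if isZero (length cs) then (av u l - isLeaf l) *ℤ isLeaf r else 0ℤ
    k₂ l r = if isNonZero (length cs) then (av τ l - isLeaf l) *ℤ isLeaf r else 0ℤ
    k₄ l r = if isNonZero (length cs) then (pre 2 l - av u l) *ℤ (suf 1 r - isLeaf r) else 0ℤ
    k₅ l r = (av u l - isLeaf l) *ℤ (av τ r - isLeaf r)

    k : Tree → Tree → ℤ
    k l r = k₁ l r +ℤ k₂ l r +ℤ block-sum 2 l r +ℤ k₄ l r +ℤ k₅ l r

  -- Splitting on `cs` decides the conditions on r. They originate in the case of an empty `r`: the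
  -- last value of `chain` has index 1 and concerns `u` if there is a single block, and concerns all
  -- of τ otherwise.
  weight : ∀ {cs} (nf : NormalForm ((u ++ m ∷ []) ∷ cs)) → let open Coefficients m<u nf in
           ∀ l r → (1ℤ - isLeaf l) *ℤ av τ (node l r) ≡ k nf l r
  weight {[]} nf leaf r = sym (trans
    (cong₂ (λ x y → (x - 1ℤ) *ℤ isLeaf r +ℤ 0ℤ +ℤ y +ℤ 0ℤ +ℤ (x - 1ℤ) *ℤ (av τ r - isLeaf r)) (av-leaf u≢[]) (block-sum-leafˡ 1 r))
    (regroup (isLeaf r) (av τ r) (av τ (node leaf r))))
    where
    open Coefficients m<u nf
    regroup : ∀ a b c → (1ℤ - 1ℤ) *ℤ a +ℤ 0ℤ +ℤ 0ℤ +ℤ 0ℤ +ℤ (1ℤ - 1ℤ) *ℤ (b - a) ≡ (1ℤ - 1ℤ) *ℤ c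
    regroup = solve-∀
  weight {[]} nf l@(node _ _) leaf = begin
    (1ℤ - 0ℤ) *ℤ av τ (node l leaf)
      ≡⟨ cong ((1ℤ - 0ℤ) *ℤ_) (τ-node-leaf l) ⟩
    (1ℤ - 0ℤ) *ℤ av u l
      ≡⟨ regroup (av u l) ⟩
    (av u l - 0ℤ) *ℤ 1ℤ +ℤ 0ℤ +ℤ 0ℤ +ℤ 0ℤ +ℤ (av u l - 0ℤ) *ℤ (1ℤ - 1ℤ)
      ≡⟨ cong (λ x → (av u l - 0ℤ) *ℤ 1ℤ +ℤ 0ℤ +ℤ 0ℤ +ℤ 0ℤ +ℤ (av u l - 0ℤ) *ℤ (x - 1ℤ)) (sym τ-leaf) ⟩
    k nf l leaf ∎
    where
    open Coefficients m<u nf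
    regroup : ∀ a → (1ℤ - 0ℤ) *ℤ a ≡ (a - 0ℤ) *ℤ 1ℤ +ℤ 0ℤ +ℤ 0ℤ +ℤ 0ℤ +ℤ (a - 0ℤ) *ℤ (1ℤ - 1ℤ)
    regroup = solve-∀
  weight {[]} nf l@(node _ _) r@(node _ _) =
    trans (cong ((1ℤ - 0ℤ) *ℤ_) (τ-node l r)) (regroup (av u l) (av τ r))
    where
    open Coefficients m<u nf
    regroup : ∀ a b → (1ℤ - 0ℤ) *ℤ ((a - 0ℤ) *ℤ b +ℤ 0ℤ) ≡ (a - 0ℤ) *ℤ 0ℤ +ℤ 0ℤ +ℤ 0ℤ +ℤ 0ℤ +ℤ (a - 0ℤ) *ℤ (b - 0ℤ)
    regroup = solve-∀
  weight {c ∷ cs} nf leaf r = sym (begin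
    0ℤ +ℤ (av τ leaf - 1ℤ) *ℤ isLeaf r +ℤ block-sum 2 leaf r +ℤ
      (pre 2 leaf - av u leaf) *ℤ (suf 1 r - isLeaf r) +ℤ (av u leaf - 1ℤ) *ℤ (av τ r - isLeaf r)
      ≡⟨ cong₂ (λ x y → 0ℤ +ℤ (x - 1ℤ) *ℤ isLeaf r +ℤ y +ℤ (pre 2 leaf - av u leaf) *ℤ (suf 1 r - isLeaf r) +ℤ
                 (av u leaf - 1ℤ) *ℤ (av τ r - isLeaf r)) τ-leaf (block-sum-leafˡ 1 r) ⟩
    0ℤ +ℤ (1ℤ - 1ℤ) *ℤ isLeaf r +ℤ 0ℤ +ℤ
      (pre 2 leaf - av u leaf) *ℤ (suf 1 r - isLeaf r) +ℤ (av u leaf - 1ℤ) *ℤ (av τ r - isLeaf r)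
      ≡⟨ cong₂ (λ x y → 0ℤ +ℤ (1ℤ - 1ℤ) *ℤ isLeaf r +ℤ 0ℤ +ℤ (x - y) *ℤ (suf 1 r - isLeaf r) +ℤ
                 (y - 1ℤ) *ℤ (av τ r - isLeaf r)) (pre-leaf 1) (av-leaf u≢[]) ⟩
    0ℤ +ℤ (1ℤ - 1ℤ) *ℤ isLeaf r +ℤ 0ℤ +ℤ (1ℤ - 1ℤ) *ℤ (suf 1 r - isLeaf r) +ℤ (1ℤ - 1ℤ) *ℤ (av τ r - isLeaf r)
      ≡⟨ regroup (isLeaf r) (suf 1 r) (av τ r) (av τ (node leaf r)) ⟩
    (1ℤ - 1ℤ) *ℤ av τ (node leaf r) ∎)
    where
    open Coefficients m<u nf
    regroup : ∀ a b c d → 0ℤ +ℤ (1ℤ - 1ℤ) *ℤ a +ℤ 0ℤ +ℤ (1ℤ - 1ℤ) *ℤ (b - a) +ℤ (1ℤ - 1ℤ) *ℤ (c - a) ≡ (1ℤ - 1ℤ) *ℤ d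
    regroup = solve-∀
  weight {c ∷ cs} nf l@(node _ _) leaf = begin
    (1ℤ - 0ℤ) *ℤ av τ (node l leaf)
      ≡⟨ cong ((1ℤ - 0ℤ) *ℤ_) (trans (τ-node-leaf l) (pre-all l)) ⟩
    (1ℤ - 0ℤ) *ℤ av τ l
      ≡⟨ regroup (av τ l) (av u l) (pre 2 l) ⟩
    0ℤ +ℤ (av τ l - 0ℤ) *ℤ 1ℤ +ℤ 0ℤ +ℤ (pre 2 l - av u l) *ℤ (1ℤ - 1ℤ) +ℤ (av u l - 0ℤ) *ℤ (1ℤ - 1ℤ)
      ≡⟨ cong₂ (λ x y → 0ℤ +ℤ (av τ l - 0ℤ) *ℤ 1ℤ +ℤ x +ℤ (pre 2 l - av u l) *ℤ (y - 1ℤ) +ℤ (av u l - 0ℤ) *ℤ (1ℤ - 1ℤ))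
           (sym (block-sum-leafʳ 1 l ≤-refl)) (sym (suf-leaf (s≤s z≤n))) ⟩
    0ℤ +ℤ (av τ l - 0ℤ) *ℤ 1ℤ +ℤ block-sum 2 l leaf +ℤ (pre 2 l - av u l) *ℤ (suf 1 leaf - 1ℤ) +ℤ
      (av u l - 0ℤ) *ℤ (1ℤ - 1ℤ)
      ≡⟨ cong (λ x → 0ℤ +ℤ (av τ l - 0ℤ) *ℤ 1ℤ +ℤ block-sum 2 l leaf +ℤ (pre 2 l - av u l) *ℤ (suf 1 leaf - 1ℤ) +ℤ
                (av u l - 0ℤ) *ℤ (x - 1ℤ)) (sym τ-leaf) ⟩
    k nf l leaf ∎
    where
    open Coefficients m<u nf
    regroup : ∀ a b c → (1ℤ - 0ℤ) *ℤ a ≡ 0ℤ +ℤ (a - 0ℤ) *ℤ 1ℤ +ℤ 0ℤ +ℤ (c - b) *ℤ (1ℤ - 1ℤ) +ℤ (b - 0ℤ) *ℤ (1ℤ - 1ℤ)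
    regroup = solve-∀
  weight {c ∷ cs} nf l@(node _ _) r@(node r₁ r₂) = begin
    (1ℤ - 0ℤ) *ℤ av τ (node l r)
      -- The summand with suffix index 1 subtracts `av u l` instead of `pre 1 l`, so it is taken out
      -- of the sum, whose regular part starts at 2.
      ≡⟨ cong ((1ℤ - 0ℤ) *ℤ_) (trans (τ-node l r) (cong ((av u l - 0ℤ) *ℤ av τ r +ℤ_)
           (∑-upTo-suc (length cs) (λ j → (pre (2 + j) l - chain l (suc j)) *ℤ suf (suc j) r)))) ⟩
    (1ℤ - 0ℤ) *ℤ ((av u l - 0ℤ) *ℤ av τ r +ℤ ((pre 2 l - av u l) *ℤ suf 1 r +ℤ rest))
      ≡⟨ regroup (av u l) (av τ r) (pre 2 l) (suf 1 r) rest (av τ l) ⟩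
    0ℤ +ℤ (av τ l - 0ℤ) *ℤ 0ℤ +ℤ rest +ℤ (pre 2 l - av u l) *ℤ (suf 1 r - 0ℤ) +ℤ (av u l - 0ℤ) *ℤ (av τ r - 0ℤ)
      ≡⟨ cong (λ x → 0ℤ +ℤ (av τ l - 0ℤ) *ℤ 0ℤ +ℤ x +ℤ (pre 2 l - av u l) *ℤ (suf 1 r - 0ℤ) +ℤ
                (av u l - 0ℤ) *ℤ (av τ r - 0ℤ)) (sym (block-sum-nodeʳ 2 l r₁ r₂)) ⟩
    k nf l r ∎
    where
    open Coefficients m<u nf
    rest = ∑ (upTo (length cs)) (λ j → (pre (3 + j) l - pre (2 + j) l) *ℤ suf (2 + j) r)
    regroup : ∀ a b c d e f → (1ℤ - 0ℤ) *ℤ ((a - 0ℤ) *ℤ b +ℤ ((c - a) *ℤ d +ℤ e)) ≡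
              0ℤ +ℤ (f - 0ℤ) *ℤ 0ℤ +ℤ e +ℤ (c - a) *ℤ (d - 0ℤ) +ℤ (a - 0ℤ) *ℤ (b - 0ℤ)
    regroup = solve-∀

  module _ {cs} (nf : NormalForm ((u ++ m ∷ []) ∷ cs)) where
    open Coefficients m<u nf

    equation : NonemptyHeadEquation τ bs u
    equation n j = trans
      (F-root _ _
        (x·q·GF₂-⊕ (λ l r → isLeaf l *ℤ isLeaf r) (λ l r → isLeaf l *ℤ (av τ r - isLeaf r)) x⊗q-GF₂
          (x⊗q⊗-GF₂ (F τ ⊖ 1ˢ) (λ r → av τ r - isLeaf r) (F⊖1-GF τ)))
        (x·GF₂-⊕ {f = s₁ ⊕ s₂ ⊕ s₃ ⊕ s₄} {g = s₅} (λ l r → k₁ nf l r +ℤ k₂ nf l r +ℤ block-sum 2 l r +ℤ k₄ nf l r) (k₅ nf)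
          (x·GF₂-⊕ {f = s₁ ⊕ s₂ ⊕ s₃} {g = s₄} (λ l r → k₁ nf l r +ℤ k₂ nf l r +ℤ block-sum 2 l r) (k₄ nf)
            (x·GF₂-⊕ {f = s₁ ⊕ s₂} {g = s₃} (λ l r → k₁ nf l r +ℤ k₂ nf l r) (block-sum 2)
              (x·GF₂-⊕ {f = s₁} {g = s₂} (k₁ nf) (k₂ nf)
                (δ-GF₂ (isZero (length cs)) (xˢ ⊗ (F u ⊖ 1ˢ)) _ (x⊗[F⊖1]-GF₂ u))
                (δ-GF₂ (isNonZero (length cs)) (xˢ ⊗ (F τ ⊖ 1ˢ)) _ (x⊗[F⊖1]-GF₂ τ)))
              (x⊗-GF₂ (blockSeries bs 2) (block-sum 2) (block-sum-GF₂ 2)))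
            (δ-GF₂ (isNonZero (length cs)) (xˢ ⊗ (F (concat (take 2 bs)) ⊖ F u) ⊗ (F (red (concat (drop 1 bs))) ⊖ 1ˢ)) _
              (x⊗⊗-GF₂ (F (concat (take 2 bs)) ⊖ F u) (F (red (concat (drop 1 bs))) ⊖ 1ˢ)
                (λ l → pre 2 l - av u l) (λ r → suf 1 r - isLeaf r)
                (F⊖F-GF (concat (take 2 bs)) u) (F-red⊖1-GF (concat (drop 1 bs))))))
          (x⊗⊗-GF₂ (F u ⊖ 1ˢ) (F τ ⊖ 1ˢ) (λ l → av u l - isLeaf l) (λ r → av τ r - isLeaf r) (F⊖1-GF u) (F⊖1-GF τ)))
        (q-weight nf) (weight nf) n j)
      (regroup (1ˢ n j) ((xˢ ⊗ qˢ) n j) ((xˢ ⊗ qˢ ⊗ (F τ ⊖ 1ˢ)) n j) (s₁ n j) (s₂ n j) (s₃ n j) (s₄ n j) (s₅ n j))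
      where
      s₁ s₂ s₃ s₄ s₅ : Series
      s₁ = δ (isZero (length cs)) (xˢ ⊗ (F u ⊖ 1ˢ))
      s₂ = δ (isNonZero (length cs)) (xˢ ⊗ (F τ ⊖ 1ˢ))
      s₃ = xˢ ⊗ blockSeries bs 2
      s₄ = δ (isNonZero (length cs)) (xˢ ⊗ (F (concat (take 2 bs)) ⊖ F u) ⊗ (F (red (concat (drop 1 bs))) ⊖ 1ˢ))
      s₅ = xˢ ⊗ (F u ⊖ 1ˢ) ⊗ (F τ ⊖ 1ˢ)
      regroup : ∀ a b c d₁ d₂ d₃ d₄ d₅ → a +ℤ (b +ℤ c) +ℤ (d₁ +ℤ d₂ +ℤ d₃ +ℤ d₄ +ℤ d₅) ≡
                a +ℤ b +ℤ d₁ +ℤ d₂ +ℤ c +ℤ d₃ +ℤ d₄ +ℤ d₅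
      regroup = solve-∀

-- From blocks to the permutation

firstDropLast : List (List ℕ) → List ℕ
firstDropLast [] = []
firstDropLast (b ∷ _) = dropLast b

tau0-≡ : ∀ τ → tau0 τ ≡ firstDropLast (blocks τ)
tau0-≡ τ with blocks τ
... | [] = refl
... | b ∷ _ = refl

dropLast-snoc : ∀ u m → dropLast (u ++ m ∷ []) ≡ u
dropLast-snoc [] m = refl
dropLast-snoc (x ∷ []) m = refl
dropLast-snoc (x ∷ y ∷ u) m = cong (x ∷_) (dropLast-snoc (y ∷ u) m)

oneTo-unique : ∀ k → Unique (oneTo k)
oneTo-unique k = subst Unique (sym (oneTo-range k)) (range-unique 0 k)

Equations : List ℕ → List (List ℕ) → List ℕ → Set
Equations τ bs u = (u ≡ [] → EmptyHeadEquation τ bs) × (u ≢ [] → NonemptyHeadEquation τ bs u)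

normalForm-equations : ∀ bs → NormalForm bs → 2 ≤ length (concat bs) → Equations (concat bs) bs (firstDropLast bs)
normalForm-equations [] _ ()
normalForm-equations (_ ∷ cs) nf@((u , m , refl , m<u , _) ∷ _ , _) 2≤ =
  subst (Equations (concat ((u ++ m ∷ []) ∷ cs)) ((u ++ m ∷ []) ∷ cs)) (sym (dropLast-snoc u m))
    (emptyHead u cs nf 2≤ , λ u≢[] → NonemptyHead.equation u≢[] m<u nf)
  where
  emptyHead : ∀ u cs (nf : NormalForm ((u ++ m ∷ []) ∷ cs)) → 2 ≤ length (concat ((u ++ m ∷ []) ∷ cs)) →
              u ≡ [] → EmptyHeadEquation (concat ((u ++ m ∷ []) ∷ cs)) ((u ++ m ∷ []) ∷ cs)
  -- A single block with empty τ^(0) is a one-letter word, excluded by the length bound; this is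
  -- where k ≥ 2 enters.
  emptyHead [] [] _ (s≤s ()) refl
  emptyHead [] (c ∷ cs) nf _ refl = EmptyHead.equation nf

theorem2p2 : (k : ℕ) → 2 ≤ k → (τ : List ℕ) → InS312 k τ →
    ((tau0 τ ≡ [] →
    F τ ≈ˢ (1ˢ ⊕ xˢ ⊗ qˢ ⊕ xˢ ⊗ (F τ ⊖ 1ˢ) ⊕ xˢ ⊗ qˢ ⊗ (F (Θsuf τ 1) ⊖ 1ˢ)
    ⊕ xˢ ⊗ sumˢ (map (λ j → (F (Θpre τ j) ⊖ F (Θpre' τ j)) ⊗ (F (Θsuf τ j) ⊖ 1ˢ)) (fromTo 1 (rOf τ)))))
    × (tau0 τ ≢ [] →
    F τ ≈ˢ (1ˢ ⊕ xˢ ⊗ qˢ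
    ⊕ δ (isZero (rOf τ)) (xˢ ⊗ (F (tau0 τ) ⊖ 1ˢ))
    ⊕ δ (isNonZero (rOf τ)) (xˢ ⊗ (F τ ⊖ 1ˢ))
    ⊕ xˢ ⊗ qˢ ⊗ (F τ ⊖ 1ˢ)
    ⊕ xˢ ⊗ sumˢ (map (λ j → (F (Θpre τ j) ⊖ F (Θpre' τ j)) ⊗ (F (Θsuf τ j) ⊖ 1ˢ)) (fromTo 2 (rOf τ)))
    ⊕ δ (isNonZero (rOf τ)) (xˢ ⊗ (F (Θpre τ 1) ⊖ F (tau0 τ)) ⊗ (F (Θsuf τ 1) ⊖ 1ˢ))
    ⊕ xˢ ⊗ (F (tau0 τ) ⊖ 1ˢ) ⊗ (F τ ⊖ 1ˢ))))
theorem2p2 k 2≤k τ (τ↭ , av) with blocksAux-normal [] τ (Unique-↭ (↭-sym τ↭) (oneTo-unique k)) (avoidsB⇒¬Contains av) (λ ())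
-- The concatenated blocks equal `τ` only propositionally, so the equations are proved for the
-- concatenation and transported along `e`.
... | nf , e = subst₂ (λ v u → Equations v (blocks τ) u) e (sym (tau0-≡ τ))
    (normalForm-equations (blocks τ) nf (subst (λ v → 2 ≤ length v) (sym e) (subst (2 ≤_) (sym length-τ) 2≤k)))
  where
  length-τ : length τ ≡ k
  length-τ = trans (↭.↭-length τ↭) (trans (length-map suc (upTo k)) (length-upTo k))
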